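{- Let $m\geq 1$, let $i_1,i_2,\ldots,i_m\geq 2$ and $q\geq 2$ be positive integers. For $0\le l\le m$, indices $1\leq j_1<\cdots<j_l\leq m$, a composition $\eta=(\eta_1,\eta_2,\ldots,\eta_p)\in\mathcal{C}_l$ (where $p$ is the number of parts of $\eta$) and a permutation $\tau\in\mathcal{S}_l$, denote $$\tilde{J}_c(\eta,\tau)=i_{j_{\tau(\eta_1+\cdots+\eta_{c-1}+1)}}+\cdots+i_{j_{\tau(\eta_1+\cdots+\eta_c)}},\qquad c=1,2,\ldots,p.$$ Then $$S_{i_1i_2\cdots i_m,q}=\sum_{l=0}^m(-1)^l\sum_{1\leq j_1<\cdots<j_l\leq m}\frac{\prod_{k=1}^m\zeta(i_k)}{\prod_{k=1}^l\zeta(i_{j_k})}\sum_{\eta\in\mathcal{C}_l}\sum_{\tau\in\mathcal{S}_l}\frac{\zeta\big(\tilde{J}_1(\eta,\tau),\tilde{J}_2(\eta,\tau),\ldots,\tilde{J}_p(\eta,\tau),q\big)}{\eta_1!\,\eta_2!\cdots\eta_p!}.$$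
   Context: Generalized harmonic numbers: $H_n^{(r)}=\sum_{k=1}^n k^{ -r}$ for positive integers $n,r$. Euler sum: $S_{i_1i_2\cdots i_m,q}=\sum_{n=1}^{\infty}\frac{H_n^{(i_1)}H_n^{(i_2)}\cdots H_n^{(i_m)}}{n^q}$. Multiple zeta values: for positive integers $s_1,\ldots,s_k$ with $s_1>1$, $\zeta(s_1,s_2,\ldots,s_k)=\sum_{n_1>n_2>\cdots>n_k\geq 1}\frac{1}{n_1^{s_1}n_2^{s_2}\cdots n_k^{s_k}}$; for $k=1$ this is the Riemann zeta value. $\mathcal{S}_l$ is the symmetric group of all permutations of $\{1,\ldots,l\}$. A composition of $l$ is an ordered tuple of positive integers whose elements sum to $l$; $\mathcal{C}_l$ is the set of all compositions of $l$. For $c=1$, the empty sum $\eta_1+\cdots+\eta_{c-1}$ is $0$. Convention for $l=0$: there is exactly one (empty) choice of indices, one (empty, $p=0$) composition and one (empty) permutation, empty products equal $1$, and the corresponding inner sum is $\zeta(q)$. -}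

module Defs where

open import Level using (0ℓ)
open import Algebra.Bundles using (CommutativeRing; RawSemiring; Semiring)
import Algebra.Definitions.RawMonoid
open import Data.Fin as Fin using (Fin; zero; suc)
import Data.Fin.Properties as Fin
open import Data.Fin.Permutation as Perm using (Permutation′; _⟨$⟩ʳ_; insert; remove)
open import Data.Integer as ℤ using (+_)
import Data.Integer.Properties as ℤ
open import Data.List.Base as List using (List; []; _∷_; _++_; foldr; map; take; drop; tabulate; allFin; cartesianProductWith)
import Data.List.Properties as List
open import Data.List.Relation.Unary.All as All using (All; []; _∷_)
import Data.List.Relation.Unary.All.Properties as All
open import Data.List.Relation.Unary.AllPairs using ([]; _∷_)
open import Data.List.Relation.Unary.Any as Any using (here; there)
import Data.List.Relation.Unary.Any.Properties as Any
import Data.List.Relation.Unary.Enumerates.Setoid as Enumerates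
import Data.List.Relation.Unary.Unique.Setoid as Unique
import Data.List.Relation.Unary.Unique.Setoid.Properties as Unique
import Data.List.Relation.Unary.Unique.Propositional.Properties as UniqueP
import Data.List.Membership.Setoid.Properties as Membership
import Data.List.Membership.Propositional.Properties as MembershipP
open import Data.Nat as ℕ using (ℕ; zero; suc; z≤n; s≤s; _!)
open import Data.Nat.ListAction using (sum; product)
import Data.Nat.Properties as ℕ
open import Data.Product using (∃; _×_; _,_; proj₁; proj₂)
open import Data.Rational as ℚ using (ℚ; mkℚ; 0ℚ; 1ℚ; ½; ∣_∣)
import Data.Rational.Properties as ℚ
open import Data.Rational.Solver using (module +-*-Solver)
open import Data.Rational.Unnormalised as ℚᵘ using (mkℚᵘ)
import Data.Rational.Unnormalised.Properties as ℚᵘ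
open import Data.Sum.Base using (inj₁; inj₂)
open import Relation.Binary.Bundles using (Setoid)
import Relation.Binary.Construct.On as On
open import Relation.Binary.PropositionalEquality as ≡ using (_≡_; _≢_; refl; cong; cong₂; subst; subst₂; _→-setoid_)
open import Relation.Nullary using (yes; no; contradiction)
open import Function.Base using (_∘_)

private
  variable
    l m n : ℕ

module Ineq where
  open import Data.Rational.Base using (_+_; _*_; _-_; -_; _≤_; _<_)
  open +-*-Solver using (solve; con; _:=_; _:+_; _:*_; _:-_; :-_)

  0<1 : 0ℚ < 1ℚ
  0<1 = ℚ.*<* (ℤ.+<+ (s≤s z≤n))

  0≤1 : 0ℚ ≤ 1ℚ
  0≤1 = ℚ.<⇒≤ 0<1

  0<½ : 0ℚ < ½
  0<½ = ℚ.*<* (ℤ.+<+ (s≤s z≤n))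

  *-pos : ∀ {p q} → 0ℚ < p → 0ℚ < q → 0ℚ < p * q
  *-pos {p} {q} 0<p 0<q = ℚ.positive⁻¹ (p * q)
    {{ℚ.pos*pos⇒pos p {{ℚ.positive 0<p}} q {{ℚ.positive 0<q}}}}

  *-nonneg : ∀ {p q} → 0ℚ ≤ p → 0ℚ ≤ q → 0ℚ ≤ p * q
  *-nonneg {p} {q} 0≤p 0≤q = ℚ.nonNegative⁻¹ (p * q)
    {{ℚ.nonNeg*nonNeg⇒nonNeg p {{ℚ.nonNegative 0≤p}} q {{ℚ.nonNegative 0≤q}}}}

  +-nonneg : ∀ {p q} → 0ℚ ≤ p → 0ℚ ≤ q → 0ℚ ≤ p + q
  +-nonneg 0≤p 0≤q = ℚ.+-mono-≤ 0≤p 0≤q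

  *-mono : ∀ {p p′ q q′} → 0ℚ ≤ p′ → 0ℚ ≤ q → p ≤ p′ → q ≤ q′ → p * q ≤ p′ * q′
  *-mono {p} {p′} {q} {q′} 0≤p′ 0≤q p≤p′ q≤q′ = ℚ.≤-trans
    (ℚ.*-monoʳ-≤-nonNeg q {{ℚ.nonNegative 0≤q}} p≤p′)
    (ℚ.*-monoˡ-≤-nonNeg p′ {{ℚ.nonNegative 0≤p′}} q≤q′)

  *-monoˡ : ∀ {p q q′} → 0ℚ ≤ p → q ≤ q′ → p * q ≤ p * q′
  *-monoˡ {p} 0≤p = ℚ.*-monoˡ-≤-nonNeg p {{ℚ.nonNegative 0≤p}}

  *-monoʳ : ∀ {p q q′} → 0ℚ ≤ p → q ≤ q′ → q * p ≤ q′ * p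
  *-monoʳ {p} 0≤p = ℚ.*-monoʳ-≤-nonNeg p {{ℚ.nonNegative 0≤p}}

  p≤p+q : ∀ {p q} → 0ℚ ≤ q → p ≤ p + q
  p≤p+q {p} 0≤q = subst (_≤ p + _) (ℚ.+-identityʳ p) (ℚ.+-monoʳ-≤ p 0≤q)

  p<p+1 : ∀ p → p < p + 1ℚ
  p<p+1 p = subst (_< p + 1ℚ) (ℚ.+-identityʳ p) (ℚ.+-monoʳ-< p 0<1)

  0≤q-p : ∀ {p q} → p ≤ q → 0ℚ ≤ q - p
  0≤q-p {p} {q} p≤q = subst (_≤ q - p) (ℚ.+-inverseʳ p) (ℚ.+-monoˡ-≤ (- p) p≤q)

  half+half : ∀ ε → ½ * ε + ½ * ε ≡ ε
  half+half ε = ≡.trans (≡.sym (ℚ.*-distribʳ-+ ε ½ ½)) (ℚ.*-identityˡ ε)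

  ∣p-q∣≡∣q-p∣ : ∀ p q → ∣ p - q ∣ ≡ ∣ q - p ∣
  ∣p-q∣≡∣q-p∣ p q = ≡.trans (≡.sym (ℚ.∣-p∣≡∣p∣ (p - q)))
    (cong ∣_∣ (solve 2 (λ a b → :- (a :- b) := b :- a) refl p q))

  ∣p-p∣<ε : ∀ p {ε} → 0ℚ < ε → ∣ p - p ∣ < ε
  ∣p-p∣<ε p 0<ε = subst (_< _) (≡.sym (cong ∣_∣ (ℚ.+-inverseʳ p))) 0<ε

  triangle : ∀ p q r → ∣ p - r ∣ ≤ ∣ p - q ∣ + ∣ q - r ∣
  triangle p q r = subst (λ t → ∣ t ∣ ≤ ∣ p - q ∣ + ∣ q - r ∣)
    (solve 3 (λ a b c → (a :- b) :+ (b :- c) := a :- c) refl p q r)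
    (ℚ.∣p+q∣≤∣p∣+∣q∣ (p - q) (q - r))

  ∣+∣-close : ∀ {a b c d δ ε} → ∣ a - c ∣ < δ → ∣ b - d ∣ < ε → ∣ (a + b) - (c + d) ∣ < δ + ε
  ∣+∣-close {a} {b} {c} {d} ac bd = ℚ.≤-<-trans
    (subst (λ t → ∣ t ∣ ≤ ∣ a - c ∣ + ∣ b - d ∣)
      (solve 4 (λ a b c d → (a :- c) :+ (b :- d) := (a :+ b) :- (c :+ d)) refl a b c d)
      (ℚ.∣p+q∣≤∣p∣+∣q∣ (a - c) (b - d)))
    (ℚ.+-mono-< ac bd)

  ∣-∣-close : ∀ {a c ε} → ∣ a - c ∣ < ε → ∣ (- a) - (- c) ∣ < ε
  ∣-∣-close {a} {c} = subst (_< _) (≡.trans (∣p-q∣≡∣q-p∣ a c)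
    (cong ∣_∣ (solve 2 (λ a c → c :- a := (:- a) :- (:- c)) refl a c)))

  ∣*∣-close : ∀ {a b c d B δ} → 0ℚ < B → ∣ a ∣ < B → ∣ d ∣ < B →
              ∣ a - c ∣ < δ → ∣ b - d ∣ < δ → ∣ (a * b) - (c * d) ∣ < B * δ + B * δ
  ∣*∣-close {a} {b} {c} {d} {B} {δ} 0<B a<B d<B ac bd = ℚ.≤-<-trans
    (subst₂ (λ t u → ∣ t ∣ ≤ u)
      (solve 4 (λ a b c d → a :* (b :- d) :+ d :* (a :- c) := (a :* b) :- (c :* d)) refl a b c d)
      (cong₂ _+_ (ℚ.∣p*q∣≡∣p∣*∣q∣ a (b - d)) (ℚ.∣p*q∣≡∣p∣*∣q∣ d (a - c)))
      (ℚ.∣p+q∣≤∣p∣+∣q∣ (a * (b - d)) (d * (a - c))))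
    (ℚ.+-mono-< (step a<B bd) (step d<B ac))
    where
    step : ∀ {p q} → ∣ p ∣ < B → ∣ q ∣ < δ → ∣ p ∣ * ∣ q ∣ < B * δ
    step {p} {q} p<B q<δ = ℚ.≤-<-trans
      (*-monoʳ (ℚ.0≤∣p∣ q) (ℚ.<⇒≤ p<B))
      (ℚ.*-monoʳ-<-pos B {{ℚ.positive 0<B}} q<δ)

open Ineq

private
  half-pos : ∀ {ε} → 0ℚ ℚ.< ε → 0ℚ ℚ.< ½ ℚ.* ε
  half-pos = *-pos 0<½

  scale : ∀ {B ε} → 0ℚ ℚ.< B → 0ℚ ℚ.< ε →
          ∃ λ δ → 0ℚ ℚ.< δ × B ℚ.* δ ℚ.+ B ℚ.* δ ≡ ε
  scale {B} {ε} 0<B 0<ε = (½ ℚ.* ε) ℚ.* 1/B , *-pos (half-pos 0<ε) 0<1/B ,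
    ≡.trans (cong₂ ℚ._+_ eq eq) (half+half ε)
    where
    instance
      B-pos : ℚ.Positive B
      B-pos = ℚ.positive 0<B
      B-nonZero : ℚ.NonZero B
      B-nonZero = ℚ.pos⇒nonZero B
    1/B : ℚ
    1/B = ℚ.1/ B
    0<1/B : 0ℚ ℚ.< 1/B
    0<1/B = ℚ.positive⁻¹ 1/B {{ℚ.1/pos⇒pos B}}
    eq : B ℚ.* ((½ ℚ.* ε) ℚ.* 1/B) ≡ ½ ℚ.* ε
    eq = ≡.trans (solve 3 (λ b e c → b :* (e :* c) := e :* (b :* c)) refl B (½ ℚ.* ε) 1/B)
      (≡.trans (cong ((½ ℚ.* ε) ℚ.*_) (ℚ.*-inverseʳ B)) (ℚ.*-identityʳ (½ ℚ.* ε)))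
      where open +-*-Solver using (solve; _:=_; _:*_)

Cauchy : (ℕ → ℚ) → Set
Cauchy x = ∀ ε → 0ℚ ℚ.< ε → ∃ λ N → ∀ m n → N ℕ.≤ m → N ℕ.≤ n → ∣ x m ℚ.- x n ∣ ℚ.< ε

∑< : ℕ → (ℕ → ℚ) → ℚ
∑< zero    a = 0ℚ
∑< (suc N) a = ∑< N a ℚ.+ a N

-- 1/[1+ n ]^ s = 1 / (n + 1) ^ s: series over n ≥ 1 are indexed from 0.
1/[1+_]^_ : ℕ → ℕ → ℚ
1/[1+ n ]^ s = ℚ._/_ (+ 1) (suc n ℕ.^ s) {{ℕ.m^n≢0 (suc n) s}}

H : ℕ → ℕ → ℚ
H r n = ∑< n (λ k → 1/[1+ k ]^ r)

-- mzv s N is the sum of 1 / (n₁ ^ s₁ ⋯ nₖ ^ sₖ) over N ≥ n₁ > ⋯ > nₖ ≥ 1.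
mzvTerm : ℕ → List ℕ → ℕ → ℚ
mzv     : List ℕ → ℕ → ℚ

mzvTerm s ss n = 1/[1+ n ]^ s ℚ.* mzv ss n

mzv []       N = 1ℚ
mzv (s ∷ ss) N = ∑< N (mzvTerm s ss)

open import Algebra.Definitions.RawMonoid ℚ.*-1-rawMonoid public
  using () renaming (sum to ∏ℚ)

eulerTerm : (Fin m → ℕ) → ℕ → ℕ → ℚ
eulerTerm i q n = ∏ℚ (λ k → H (i k) (suc n)) ℚ.* 1/[1+ n ]^ q

-- The growth of harmonic sums is measured against
-- w e n = ∏_{k=1}^n (1 + 3^{-e} / k), which grows like n^{3^{-e}}.
module Convergence where
  open import Data.Rational.Base using (_+_; _*_; _-_; -_; _≤_; _<_; _/_)
  open +-*-Solver using (solve; con; _:=_; _:+_; _:*_; _:-_; :-_)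

  inv : (a : ℕ) → .{{ℕ.NonZero a}} → ℚ
  inv a = (+ 1) / a

  inv-* : ∀ a b .{{_ : ℕ.NonZero a}} .{{_ : ℕ.NonZero b}} →
          inv (a ℕ.* b) {{ℕ.m*n≢0 a b}} ≡ inv a * inv b
  inv-* a@(suc a-1) b@(suc b-1) = ℚ.toℚᵘ-injective (ℚᵘ.≃-trans
    (ℚ.toℚᵘ-fromℚᵘ (mkℚᵘ (+ 1) (b-1 ℕ.+ a-1 ℕ.* b)))
    (ℚᵘ.≃-trans
      (ℚᵘ.*-cong (ℚᵘ.≃-sym (ℚ.toℚᵘ-fromℚᵘ (mkℚᵘ (+ 1) a-1)))
                 (ℚᵘ.≃-sym (ℚ.toℚᵘ-fromℚᵘ (mkℚᵘ (+ 1) b-1))))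
      (ℚᵘ.≃-sym (ℚ.toℚᵘ-homo-* (inv a) (inv b)))))

  inv-cong : ∀ {a b} .{{_ : ℕ.NonZero a}} .{{_ : ℕ.NonZero b}} → a ≡ b → inv a ≡ inv b
  inv-cong refl = refl

  inv-pos : ∀ a .{{_ : ℕ.NonZero a}} → 0ℚ < inv a
  inv-pos a = ℚ.positive⁻¹ (inv a) {{ℚ.normalize-pos 1 a}}

  inv-anti : ∀ a b .{{_ : ℕ.NonZero a}} .{{_ : ℕ.NonZero b}} → a ℕ.≤ b → inv b ≤ inv a
  inv-anti a@(suc a-1) b@(suc b-1) a≤b = ℚ.toℚᵘ-cancel-≤
    (ℚᵘ.≤-trans (ℚᵘ.≤-reflexive (ℚ.toℚᵘ-fromℚᵘ (mkℚᵘ (+ 1) b-1)))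
      (ℚᵘ.≤-trans (ℚᵘ.*≤* (subst₂ ℤ._≤_ (≡.sym (ℤ.*-identityˡ (+ a))) (≡.sym (ℤ.*-identityˡ (+ b))) (ℤ.+≤+ a≤b)))
        (ℚᵘ.≤-reflexive (ℚᵘ.≃-sym (ℚ.toℚᵘ-fromℚᵘ (mkℚᵘ (+ 1) a-1))))))

  r : ℕ → ℚ
  r n = inv (suc n)

  r-pos : ∀ n → 0ℚ < r n
  r-pos n = inv-pos (suc n)

  r≥0 : ∀ n → 0ℚ ≤ r n
  r≥0 n = ℚ.<⇒≤ (r-pos n)

  r≤1 : ∀ n → r n ≤ 1ℚ
  r≤1 n = inv-anti 1 (suc n) (s≤s z≤n)

  ⟦_⟧ : ℕ → ℚ
  ⟦ zero ⟧  = 0ℚ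
  ⟦ suc n ⟧ = ⟦ n ⟧ + 1ℚ

  ⟦⟧-/ : ∀ n → ⟦ n ⟧ ≡ (+ n) / 1
  ⟦⟧-/ zero = refl
  ⟦⟧-/ (suc n) = ≡.trans (cong (_+ 1ℚ) (⟦⟧-/ n)) (ℚ.toℚᵘ-injective (ℚᵘ.≃-trans
    (ℚ.toℚᵘ-homo-+ ((+ n) / 1) 1ℚ)
    (ℚᵘ.≃-trans (ℚᵘ.+-cong (ℚ.toℚᵘ-fromℚᵘ (mkℚᵘ (+ n) 0)) (ℚᵘ.≃-refl {mkℚᵘ (+ 1) 0}))
      (ℚᵘ.≃-trans (ℚᵘ.*≡* (cong (ℤ._* (+ 1)) (≡.trans (cong (ℤ._+ (+ 1)) (ℤ.*-identityʳ (+ n))) (cong +_ (ℕ.+-comm n 1)))))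
        (ℚᵘ.≃-sym (ℚ.toℚᵘ-fromℚᵘ (mkℚᵘ (+ suc n) 0)))))))

  r-inverse : ∀ n → r n * ⟦ suc n ⟧ ≡ 1ℚ
  r-inverse n = ≡.trans (cong (r n *_) (⟦⟧-/ (suc n))) (ℚ.toℚᵘ-injective (ℚᵘ.≃-trans
    (ℚ.toℚᵘ-homo-* (r n) ((+ suc n) / 1))
    (ℚᵘ.≃-trans (ℚᵘ.*-cong (ℚ.toℚᵘ-fromℚᵘ (mkℚᵘ (+ 1) n)) (ℚ.toℚᵘ-fromℚᵘ (mkℚᵘ (+ suc n) 0)))
      (ℚᵘ.*≡* (≡.trans (ℤ.*-identityʳ _) (≡.sym (≡.trans (ℤ.*-identityˡ _) (≡.trans (cong (λ t → + suc t) (ℕ.*-identityʳ n)) (≡.sym (ℤ.*-identityˡ (+ suc n)))))))))))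

  r-step : ∀ n → r n - r (suc n) ≡ r n * r (suc n)
  r-step n = begin
    r n - r (suc n)
      ≡⟨ cong₂ _-_ (ℚ.*-identityʳ (r n)) (ℚ.*-identityʳ (r (suc n))) ⟨
    r n * 1ℚ - r (suc n) * 1ℚ
      ≡⟨ cong₂ (λ a b → r n * a - r (suc n) * b) (r-inverse (suc n)) (r-inverse n) ⟨
    r n * (r (suc n) * (⟦ suc n ⟧ + 1ℚ)) - r (suc n) * (r n * ⟦ suc n ⟧)
      ≡⟨ solve 3 (λ a b c → a :* (b :* (c :+ con 1ℚ)) :- b :* (a :* c) := a :* b) refl (r n) (r (suc n)) ⟦ suc n ⟧ ⟩
    r n * r (suc n) ∎
    where open ≡.≡-Reasoning

  r-double : ∀ n → r n ≤ r (suc n) + r (suc n)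
  r-double n = subst₂ _≤_
    (≡.trans (cong (_+ r (suc n)) (≡.sym (r-step n)))
      (solve 2 (λ a b → (a :- b) :+ b := a) refl (r n) (r (suc n))))
    (cong (_+ r (suc n)) (ℚ.*-identityˡ (r (suc n))))
    (ℚ.+-monoˡ-≤ (r (suc n)) (*-monoʳ (r≥0 (suc n)) (r≤1 n)))

  archimedes : ∀ δ → 0ℚ < δ → ∃ λ N → r N < δ
  archimedes (mkℚ (+ zero) _ _) (ℚ.*<* (ℤ.+<+ ()))
  archimedes (mkℚ ℤ.-[1+ _ ] _ _) (ℚ.*<* ())
  archimedes δ@(mkℚ (+ suc k) d _) _ = suc d , ℚ.toℚᵘ-cancel-<
    (ℚᵘ.≤-<-trans (ℚᵘ.≤-reflexive (ℚ.toℚᵘ-fromℚᵘ (mkℚᵘ (+ 1) (suc d))))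
      (ℚᵘ.*<* (subst (ℤ._< + (suc k ℕ.* suc (suc d))) (≡.sym (ℤ.*-identityˡ (+ suc d)))
        (ℤ.+<+ (ℕ.≤-trans (ℕ.n<1+n (suc d)) (ℕ.m≤m+n _ (k ℕ.* suc (suc d))))))))

  powers : ∀ n s t → 1/[1+ n ]^ (s ℕ.+ t) ≡ 1/[1+ n ]^ s * 1/[1+ n ]^ t
  powers n s t = ≡.trans
    (inv-cong {{ℕ.m^n≢0 (suc n) (s ℕ.+ t)}} {{ℕ.m*n≢0 (suc n ℕ.^ s) (suc n ℕ.^ t) {{ℕ.m^n≢0 (suc n) s}} {{ℕ.m^n≢0 (suc n) t}}}}
      (ℕ.^-distribˡ-+-* (suc n) s t))
    (inv-* (suc n ℕ.^ s) (suc n ℕ.^ t) {{ℕ.m^n≢0 (suc n) s}} {{ℕ.m^n≢0 (suc n) t}})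

  power-one : ∀ n → 1/[1+ n ]^ 1 ≡ r n
  power-one n = inv-cong {{ℕ.m^n≢0 (suc n) 1}} (ℕ.^-identityʳ (suc n))

  power-pos : ∀ n s → 0ℚ < 1/[1+ n ]^ s
  power-pos n s = inv-pos (suc n ℕ.^ s) {{ℕ.m^n≢0 (suc n) s}}

  power≥0 : ∀ n s → 0ℚ ≤ 1/[1+ n ]^ s
  power≥0 n s = ℚ.<⇒≤ (power-pos n s)

  power≤1 : ∀ n s → 1/[1+ n ]^ s ≤ 1ℚ
  power≤1 n s = inv-anti 1 (suc n ℕ.^ s) {{_}} {{ℕ.m^n≢0 (suc n) s}} (ℕ.m^n>0 (suc n) s)

  power≤r : ∀ n {s} → 1 ℕ.≤ s → 1/[1+ n ]^ s ≤ r n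
  power≤r n {suc s} _ = subst₂ _≤_
    (≡.sym (powers n 1 s))
    (≡.trans (ℚ.*-identityʳ _) (power-one n))
    (*-monoˡ (power≥0 n 1) (power≤1 n s))

  power≤r² : ∀ n {s} → 2 ℕ.≤ s → 1/[1+ n ]^ s ≤ r n * r n
  power≤r² n {suc s} (s≤s 1≤s) = subst₂ _≤_
    (≡.sym (powers n 1 s))
    (cong (_* r n) (power-one n))
    (*-monoˡ (power≥0 n 1) (power≤r n 1≤s))

  ⅓ : ℚ
  ⅓ = (+ 1) / 3

  3ℚ : ℚ
  3ℚ = (+ 3) / 1

  θ ι : ℕ → ℚ
  θ zero    = 1ℚ
  θ (suc e) = ⅓ * θ e
  ι zero    = 1ℚ
  ι (suc e) = 3ℚ * ι e

  0≤⅓ : 0ℚ ≤ ⅓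
  0≤⅓ = ℚ.*≤* (ℤ.+≤+ z≤n)

  θ≥0 : ∀ e → 0ℚ ≤ θ e
  θ≥0 zero    = 0≤1
  θ≥0 (suc e) = *-nonneg 0≤⅓ (θ≥0 e)

  θ≤1 : ∀ e → θ e ≤ 1ℚ
  θ≤1 zero    = ℚ.≤-refl
  θ≤1 (suc e) = *-mono {⅓} {1ℚ} {θ e} {1ℚ} 0≤1 (θ≥0 e) (ℚ.*≤* (ℤ.+≤+ (s≤s z≤n))) (θ≤1 e)

  ι≥0 : ∀ e → 0ℚ ≤ ι e
  ι≥0 zero    = 0≤1
  ι≥0 (suc e) = *-nonneg {3ℚ} (ℚ.*≤* (ℤ.+≤+ z≤n)) (ι≥0 e)

  ι*θ : ∀ e → ι e * θ e ≡ 1ℚ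
  ι*θ zero    = refl
  ι*θ (suc e) = ≡.trans
    (solve 2 (λ a b → (con 3ℚ :* a) :* (con ⅓ :* b) := a :* b) refl (ι e) (θ e)) (ι*θ e)

  w : ℕ → ℕ → ℚ
  w e zero    = 1ℚ
  w e (suc n) = w e n * (1ℚ + θ e * r n)

  w≥0 : ∀ e n → 0ℚ ≤ w e n
  w≥0 e zero    = 0≤1
  w≥0 e (suc n) = *-nonneg (w≥0 e n) (+-nonneg 0≤1 (*-nonneg (θ≥0 e) (r≥0 n)))

  w-incr : ∀ e n → w e n ≤ w e (suc n)
  w-incr e n = subst (_≤ w e (suc n)) (ℚ.*-identityʳ (w e n))
    (*-monoˡ (w≥0 e n) (p≤p+q (*-nonneg (θ≥0 e) (r≥0 n))))

  1≤w : ∀ e n → 1ℚ ≤ w e n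
  1≤w e zero    = ℚ.≤-refl
  1≤w e (suc n) = ℚ.≤-trans (1≤w e n) (w-incr e n)

  2ℚ : ℚ
  2ℚ = 1ℚ + 1ℚ

  w-double : ∀ e n → w e (suc n) ≤ 2ℚ * w e n
  w-double e n = subst (w e (suc n) ≤_) (ℚ.*-comm (w e n) 2ℚ)
    (*-monoˡ (w≥0 e n) (ℚ.+-monoʳ-≤ 1ℚ (*-mono {θ e} {1ℚ} {r n} {1ℚ} 0≤1 (r≥0 n) (θ≤1 e) (r≤1 n))))

  w² : ∀ e n → w (suc e) n * w (suc e) n ≤ w e n
  w² e zero    = ℚ.≤-refl
  w² e (suc n) = subst (_≤ w e (suc n))
    (solve 2 (λ a b → (a :* a) :* (b :* b) := (a :* b) :* (a :* b)) refl (w (suc e) n) (1ℚ + θ (suc e) * r n))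
    (*-mono (w≥0 e n) (*-nonneg 0≤b 0≤b) (w² e n) sq)
    where
    t : ℚ
    t = θ e * r n
    0≤t : 0ℚ ≤ t
    0≤t = *-nonneg (θ≥0 e) (r≥0 n)
    t≤1 : t ≤ 1ℚ
    t≤1 = *-mono {θ e} {1ℚ} {r n} {1ℚ} 0≤1 (r≥0 n) (θ≤1 e) (r≤1 n)
    0≤b : 0ℚ ≤ 1ℚ + θ (suc e) * r n
    0≤b = +-nonneg 0≤1 (*-nonneg (θ≥0 (suc e)) (r≥0 n))
    sq : (1ℚ + θ (suc e) * r n) * (1ℚ + θ (suc e) * r n) ≤ 1ℚ + t
    sq = ℚ.≤-trans
      (ℚ.≤-reflexive (solve 2 (λ a b → (con 1ℚ :+ (con ⅓ :* a) :* b) :* (con 1ℚ :+ (con ⅓ :* a) :* b)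
         := (con 1ℚ :+ con (2ℚ * ⅓) :* (a :* b)) :+ con (⅓ * ⅓) :* ((a :* b) :* (a :* b))) refl (θ e) (r n)))
      (ℚ.≤-trans
        (ℚ.+-monoʳ-≤ (1ℚ + (2ℚ * ⅓) * t)
          (*-mono {⅓ * ⅓} {⅓} {t * t} {t} 0≤⅓ (*-nonneg 0≤t 0≤t) (ℚ.*≤* (ℤ.+≤+ (s≤s (s≤s (s≤s z≤n)))))
            (subst (t * t ≤_) (ℚ.*-identityʳ t) (*-monoˡ 0≤t t≤1))))
        (ℚ.≤-reflexive (solve 1 (λ t → (con 1ℚ :+ con (2ℚ * ⅓) :* t) :+ con ⅓ :* t := con 1ℚ :+ t) refl t)))

  w₀ : ∀ n → w 0 n ≡ ⟦ suc n ⟧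
  w₀ zero    = refl
  w₀ (suc n) = ≡.trans (cong (_* (1ℚ + 1ℚ * r n)) (w₀ n))
    (≡.trans (solve 2 (λ a b → a :* (con 1ℚ :+ con 1ℚ :* b) := a :+ b :* a) refl ⟦ suc n ⟧ (r n))
      (cong (λ t → ⟦ suc n ⟧ + t) (r-inverse n)))

  Slow : (ℕ → ℚ) → Set
  Slow f = ∀ e → ∃ λ C → 0ℚ ≤ C × ∀ n → f n ≤ C * w e n

  ∑<-nonneg : ∀ {a} → (∀ n → 0ℚ ≤ a n) → ∀ N → 0ℚ ≤ ∑< N a
  ∑<-nonneg 0≤a zero    = ℚ.≤-refl
  ∑<-nonneg 0≤a (suc N) = +-nonneg (∑<-nonneg 0≤a N) (0≤a N)

  ∑<-cong : ∀ {a b} → (∀ n → a n ≡ b n) → ∀ N → ∑< N a ≡ ∑< N b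
  ∑<-cong a≡b zero    = refl
  ∑<-cong a≡b (suc N) = cong₂ _+_ (∑<-cong a≡b N) (a≡b N)

  slow-1 : Slow (λ _ → 1ℚ)
  slow-1 e = 1ℚ , 0≤1 , λ n → subst (1ℚ ≤_) (≡.sym (ℚ.*-identityˡ (w e n))) (1≤w e n)

  slow-∑ : ∀ {f s} → 1 ℕ.≤ s → (∀ n → 0ℚ ≤ f n) → Slow f → Slow (λ N → ∑< N (λ n → 1/[1+ n ]^ s * f n))
  slow-∑ {f} {s} 1≤s 0≤f slow e with slow e
  ... | C , 0≤C , f≤ = C * ι e , *-nonneg 0≤C (ι≥0 e) , go
    where
    go : ∀ N → ∑< N (λ n → 1/[1+ n ]^ s * f n) ≤ (C * ι e) * w e N
    go zero    = *-nonneg (*-nonneg 0≤C (ι≥0 e)) 0≤1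
    go (suc N) = ℚ.≤-trans
      (ℚ.+-mono-≤ (go N) (*-mono (r≥0 N) (0≤f N) (power≤r N 1≤s) (f≤ N)))
      (ℚ.≤-reflexive (begin
        (C * ι e) * w e N + r N * (C * w e N)
          ≡⟨ cong (λ t → (C * ι e) * w e N + t) (ℚ.*-identityˡ (r N * (C * w e N))) ⟨
        (C * ι e) * w e N + 1ℚ * (r N * (C * w e N))
          ≡⟨ cong (λ t → (C * ι e) * w e N + t * (r N * (C * w e N))) (ι*θ e) ⟨
        (C * ι e) * w e N + (ι e * θ e) * (r N * (C * w e N))
          ≡⟨ solve 5 (λ C i t r w → (C :* i) :* w :+ (i :* t) :* (r :* (C :* w))
               := (C :* i) :* (w :* (con 1ℚ :+ t :* r))) refl C (ι e) (θ e) (r N) (w e N) ⟩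
        (C * ι e) * w e (suc N) ∎))
      where open ≡.≡-Reasoning

  slow-* : ∀ {f g} → (∀ n → 0ℚ ≤ g n) → Slow f → Slow g → Slow (λ n → f n * g n)
  slow-* {f} {g} 0≤g sf sg e with sf (suc e) | sg (suc e)
  ... | C , 0≤C , f≤ | D , 0≤D , g≤ = C * D , *-nonneg 0≤C 0≤D , λ n → ℚ.≤-trans
    (*-mono (*-nonneg 0≤C (w≥0 (suc e) n)) (0≤g n) (f≤ n) (g≤ n))
    (ℚ.≤-trans
      (ℚ.≤-reflexive (solve 3 (λ C D w → (C :* w) :* (D :* w) := (C :* D) :* (w :* w)) refl C D (w (suc e) n)))
      (*-monoˡ (*-nonneg 0≤C 0≤D) (w² e n)))

  slow-suc : ∀ {f} → Slow f → Slow (f ∘ suc)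
  slow-suc {f} sf e with sf e
  ... | C , 0≤C , f≤ = C * 2ℚ , *-nonneg 0≤C (ℚ.<⇒≤ (ℚ.+-mono-< 0<1 0<1)) , λ n →
    ℚ.≤-trans (f≤ (suc n))
      (subst (C * w e (suc n) ≤_) (≡.sym (ℚ.*-assoc C 2ℚ (w e n))) (*-monoˡ 0≤C (w-double e n)))

  -- v bounds the tails of ∑ w 1 n / (n + 1) ^ 2 up to a constant factor.
  v : ℕ → ℚ
  v n = w 1 n * r n

  v≥0 : ∀ n → 0ℚ ≤ v n
  v≥0 n = *-nonneg (w≥0 1 n) (r≥0 n)

  v-step : ∀ n → w 1 n * (r n * r n) ≤ 3ℚ * (v n - v (suc n))
  v-step n = ℚ.≤-trans
    (*-monoˡ (w≥0 1 n) (*-monoˡ (r≥0 n) (r-double n)))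
    (ℚ.≤-reflexive (begin
      w 1 n * (r n * (r (suc n) + r (suc n)))
        ≡⟨ solve 3 (λ w a b → w :* (a :* (b :+ b)) := (con 3ℚ :* w) :* (a :* b) :- w :* (a :* b)) refl (w 1 n) (r n) (r (suc n)) ⟩
      (3ℚ * w 1 n) * (r n * r (suc n)) - w 1 n * (r n * r (suc n))
        ≡⟨ cong (λ t → (3ℚ * w 1 n) * t - w 1 n * (r n * r (suc n))) (r-step n) ⟨
      (3ℚ * w 1 n) * (r n - r (suc n)) - w 1 n * (r n * r (suc n))
        ≡⟨ solve 3 (λ w a b → (con 3ℚ :* w) :* (a :- b) :- w :* (a :* b)
             := con 3ℚ :* (w :* a :- (w :* (con 1ℚ :+ con (⅓ * 1ℚ) :* a)) :* b)) refl (w 1 n) (r n) (r (suc n)) ⟩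
      3ℚ * (v n - v (suc n)) ∎))
    where open ≡.≡-Reasoning

  v²≤r : ∀ n → v n * v n ≤ r n
  v²≤r n = ℚ.≤-trans
    (ℚ.≤-reflexive (solve 2 (λ a b → (a :* b) :* (a :* b) := (b :* b) :* (a :* a)) refl (w 1 n) (r n)))
    (ℚ.≤-trans (*-monoˡ (*-nonneg (r≥0 n) (r≥0 n)) (w² 0 n))
      (ℚ.≤-reflexive (≡.trans (cong ((r n * r n) *_) (w₀ n))
        (≡.trans (ℚ.*-assoc (r n) (r n) ⟦ suc n ⟧)
          (≡.trans (cong (r n *_) (r-inverse n)) (ℚ.*-identityʳ (r n)))))))

  Null : (ℕ → ℚ) → Set
  Null u = ∀ ε → 0ℚ < ε → ∃ λ N → u N < ε

  v-null : Null v
  v-null ε 0<ε with archimedes (ε * ε) (*-pos 0<ε 0<ε)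
  ... | N , rN<ε² = N , ℚ.≰⇒> λ ε≤v → ℚ.<-irrefl refl
    (ℚ.<-≤-trans (ℚ.≤-<-trans (v²≤r N) rN<ε²) (*-mono (v≥0 N) (ℚ.<⇒≤ 0<ε) ε≤v ε≤v))

  monotone-Cauchy : ∀ {x u : ℕ → ℚ} → (∀ n → x n ≤ x (suc n)) →
                    (∀ n → x (suc n) + u (suc n) ≤ x n + u n) → (∀ n → 0ℚ ≤ u n) →
                    Null u → Cauchy x
  monotone-Cauchy {x} {u} incr decr u≥0 null ε 0<ε with null ε 0<ε
  ... | N , uN<ε = N , λ m n N≤m N≤n → close (lower N≤m) (upper N≤m) (lower N≤n) (upper N≤n)
    where
    lower′ : ∀ k → x N ≤ x (k ℕ.+ N)
    lower′ zero    = ℚ.≤-refl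
    lower′ (suc k) = ℚ.≤-trans (lower′ k) (incr (k ℕ.+ N))
    upper′ : ∀ k → x (k ℕ.+ N) + u (k ℕ.+ N) ≤ x N + u N
    upper′ zero    = ℚ.≤-refl
    upper′ (suc k) = ℚ.≤-trans (decr (k ℕ.+ N)) (upper′ k)
    lower : ∀ {m} → N ℕ.≤ m → x N ≤ x m
    lower N≤m = subst (λ t → x N ≤ x t) (ℕ.m∸n+n≡m N≤m) (lower′ _)
    upper : ∀ {m} → N ℕ.≤ m → x m ≤ x N + u N
    upper {m} N≤m = ℚ.≤-trans (p≤p+q (u≥0 m))
      (subst (λ t → x t + u t ≤ x N + u N) (ℕ.m∸n+n≡m N≤m) (upper′ _))
    half : ∀ {a b} → x N ≤ b → a ≤ x N + u N → a - b ≤ u N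
    half {a} {b} lb ua = ℚ.≤-trans (ℚ.+-mono-≤ ua (ℚ.neg-antimono-≤ lb))
      (ℚ.≤-reflexive (solve 2 (λ p q → (p :+ q) :- p := q) refl (x N) (u N)))
    close : ∀ {a b} → x N ≤ a → a ≤ x N + u N → x N ≤ b → b ≤ x N + u N → ∣ a - b ∣ < ε
    close {a} {b} la ua lb ub with ℚ.≤-total b a
    ... | inj₁ b≤a = ℚ.≤-<-trans
      (ℚ.≤-trans (ℚ.≤-reflexive (ℚ.0≤p⇒∣p∣≡p (0≤q-p b≤a))) (half lb ua)) uN<ε
    ... | inj₂ a≤b = ℚ.≤-<-trans
      (ℚ.≤-trans (ℚ.≤-reflexive (≡.trans (∣p-q∣≡∣q-p∣ a b) (ℚ.0≤p⇒∣p∣≡p (0≤q-p a≤b)))) (half la ub)) uN<ε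

  scale-null : ∀ {u} K → 0ℚ < K → Null u → Null (λ n → K * u n)
  scale-null {u} K 0<K null ε 0<ε =
    let (δ , 0<δ , eq) = scale {K} {ε} 0<K 0<ε
        (N , uN<δ)     = null δ 0<δ
    in N , ℚ.<-≤-trans {K * u N} {K * δ} {ε}
         (ℚ.*-monoʳ-<-pos K {{ℚ.positive 0<K}} {u N} {δ} uN<δ)
         (subst (K * δ ≤_) eq (p≤p+q {K * δ} {K * δ} (*-nonneg {K} {δ} (ℚ.<⇒≤ 0<K) (ℚ.<⇒≤ 0<δ))))

  potential-Cauchy : ∀ {x u} K → 0ℚ < K → (∀ n → 0ℚ ≤ u n) → Null u → (∀ n → x n ≤ x (suc n)) →
                     (∀ n → x (suc n) ≤ x n + K * (u n - u (suc n))) → Cauchy x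
  potential-Cauchy {x} {u} K 0<K u≥0 null incr step = monotone-Cauchy {x} {λ n → K * u n} incr
    (λ n → ℚ.≤-trans (ℚ.+-monoˡ-≤ (K * u (suc n)) (step n)) (ℚ.≤-reflexive (collect (x n) (u n) (u (suc n)))))
    (λ n → *-nonneg {K} {u n} (ℚ.<⇒≤ 0<K) (u≥0 n)) (scale-null {u} K 0<K null)
    where
    collect : ∀ y a b → (y + K * (a - b)) + K * b ≡ y + K * a
    collect y a b = solve 4 (λ y K a b → (y :+ K :* (a :- b)) :+ K :* b := y :+ K :* a) refl y K a b

  slow-Cauchy : ∀ {f s} → 2 ℕ.≤ s → (∀ n → 0ℚ ≤ f n) → Slow f →
                Cauchy (λ N → ∑< N (λ n → 1/[1+ n ]^ s * f n))
  slow-Cauchy {f} {s} 2≤s 0≤f slow with slow 1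
  ... | C , 0≤C , f≤ = potential-Cauchy {λ N → ∑< N a} {v} ((C + 1ℚ) * 3ℚ)
    (*-pos {C + 1ℚ} {3ℚ} 0<C+1 (ℚ.*<* (ℤ.+<+ (s≤s z≤n))))
    v≥0 v-null
    (λ n → p≤p+q {∑< n a} {a n} (*-nonneg (power≥0 n s) (0≤f n)))
    (λ n → ℚ.+-monoʳ-≤ (∑< n a) (term n))
    where
    a : ℕ → ℚ
    a n = 1/[1+ n ]^ s * f n
    0<C+1 : 0ℚ < C + 1ℚ
    0<C+1 = ℚ.≤-<-trans 0≤C (p<p+1 C)
    swap : ∀ a C w → a * (C * w) ≡ C * (w * a)
    swap a C w = solve 3 (λ a C w → a :* (C :* w) := C :* (w :* a)) refl a C w
    term : ∀ n → a n ≤ ((C + 1ℚ) * 3ℚ) * (v n - v (suc n))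
    term n = let open ℚ.≤-Reasoning in begin
      1/[1+ n ]^ s * f n                       ≤⟨ *-mono (*-nonneg (r≥0 n) (r≥0 n)) (0≤f n) (power≤r² n 2≤s) (f≤ n) ⟩
      (r n * r n) * (C * w 1 n)                ≡⟨ swap (r n * r n) C (w 1 n) ⟩
      C * (w 1 n * (r n * r n))                ≤⟨ *-mono (ℚ.<⇒≤ 0<C+1) (*-nonneg (w≥0 1 n) (*-nonneg (r≥0 n) (r≥0 n))) (ℚ.<⇒≤ (p<p+1 C)) (v-step n) ⟩
      (C + 1ℚ) * (3ℚ * (v n - v (suc n)))      ≡⟨ ℚ.*-assoc (C + 1ℚ) 3ℚ (v n - v (suc n)) ⟨
      ((C + 1ℚ) * 3ℚ) * (v n - v (suc n))      ∎

  mzv≥0 : ∀ ss N → 0ℚ ≤ mzv ss N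
  mzv≥0 []       N = 0≤1
  mzv≥0 (s ∷ ss) N = ∑<-nonneg (λ n → *-nonneg (power≥0 n s) (mzv≥0 ss n)) N

  mzv-slow : ∀ {ss} → All (1 ℕ.≤_) ss → Slow (mzv ss)
  mzv-slow []           = slow-1
  mzv-slow {_ ∷ ss} (1≤s ∷ 1≤ss) = slow-∑ 1≤s (mzv≥0 ss) (mzv-slow 1≤ss)

  H≥0 : ∀ i n → 0ℚ ≤ H i n
  H≥0 i = ∑<-nonneg (λ n → power≥0 n i)

  H-slow : ∀ {i} → 1 ℕ.≤ i → Slow (H i)
  H-slow {i} 1≤i e with slow-∑ 1≤i (λ _ → 0≤1) slow-1 e
  ... | C , 0≤C , h = C , 0≤C , λ n →
    subst (_≤ C * w e n) (∑<-cong (λ k → ℚ.*-identityʳ (1/[1+ k ]^ i)) n) (h n)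

  ∏H≥0 : ∀ {m} (i : Fin m → ℕ) n → 0ℚ ≤ ∏ℚ (λ k → H (i k) n)
  ∏H≥0 {zero}  i n = 0≤1
  ∏H≥0 {suc m} i n = *-nonneg (H≥0 (i zero) n) (∏H≥0 (i ∘ suc) n)

  ∏H-slow : ∀ {m} (i : Fin m → ℕ) → (∀ k → 1 ℕ.≤ i k) → Slow (λ n → ∏ℚ (λ k → H (i k) n))
  ∏H-slow {zero}  i 1≤i = slow-1
  ∏H-slow {suc m} i 1≤i = slow-* {H (i zero)} (∏H≥0 (i ∘ suc)) (H-slow (1≤i zero)) (∏H-slow (i ∘ suc) (1≤i ∘ suc))

  Cauchy-cong : ∀ {x y} → (∀ n → x n ≡ y n) → Cauchy x → Cauchy y
  Cauchy-cong x≡y c ε 0<ε with c ε 0<ε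
  ... | N , p = N , λ m n h k → subst₂ (λ a b → ∣ a - b ∣ < ε) (x≡y m) (x≡y n) (p m n h k)

open Convergence

mzv-Cauchy : ∀ {s ss} → 2 ℕ.≤ s → All (1 ℕ.≤_) ss → Cauchy (mzv (s ∷ ss))
mzv-Cauchy {s} {ss} 2≤s 1≤ss = slow-Cauchy 2≤s (mzv≥0 ss) (mzv-slow 1≤ss)

euler-Cauchy : (i : Fin m → ℕ) (q : ℕ) → (∀ k → 1 ℕ.≤ i k) → 2 ℕ.≤ q →
               Cauchy (λ N → ∑< N (eulerTerm i q))
euler-Cauchy i q 1≤i 2≤q = Cauchy-cong
  (∑<-cong (λ n → ℚ.*-comm (1/[1+ n ]^ q) (∏ℚ (λ k → H (i k) (suc n)))))
  (slow-Cauchy 2≤q (λ n → ∏H≥0 i (suc n)) (slow-suc (∏H-slow i 1≤i)))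

record ℝ : Set where
  constructor mkℝ
  field
    seq    : ℕ → ℚ
    cauchy : Cauchy seq

open ℝ public

infix 4 _≃_

_≃_ : ℝ → ℝ → Set
x ≃ y = ∀ ε → 0ℚ ℚ.< ε → ∃ λ N → ∀ n → N ℕ.≤ n → ∣ seq x n ℚ.- seq y n ∣ ℚ.< ε

≃-pointwise : ∀ {x y} → (∀ n → seq x n ≡ seq y n) → x ≃ y
≃-pointwise {x} {y} eq ε 0<ε = 0 , λ n _ →
  subst (λ t → ∣ t ℚ.- seq y n ∣ ℚ.< ε) (≡.sym (eq n)) (∣p-p∣<ε (seq y n) 0<ε)

private
  ≃-refl : ∀ {x} → x ≃ x
  ≃-refl {x} = ≃-pointwise {x} {x} (λ _ → refl)

  ≃-sym : ∀ {x y} → x ≃ y → y ≃ x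
  ≃-sym {x} {y} x≃y ε 0<ε with x≃y ε 0<ε
  ... | N , p = N , λ n N≤n → subst (ℚ._< ε) (∣p-q∣≡∣q-p∣ (seq x n) (seq y n)) (p n N≤n)

  ≃-trans : ∀ {x y z} → x ≃ y → y ≃ z → x ≃ z
  ≃-trans {x} {y} {z} x≃y y≃z ε 0<ε
    with x≃y (½ ℚ.* ε) (half-pos 0<ε) | y≃z (½ ℚ.* ε) (half-pos 0<ε)
  ... | N , p | M , q = N ℕ.⊔ M , λ n h →
    ℚ.≤-<-trans (triangle (seq x n) (seq y n) (seq z n))
      (subst (_ ℚ.<_) (half+half ε)
        (ℚ.+-mono-< (p n (ℕ.m⊔n≤o⇒m≤o N M h)) (q n (ℕ.m⊔n≤o⇒n≤o N M h))))

fromℚ : ℚ → ℝ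
fromℚ p = mkℝ (λ _ → p) (λ ε 0<ε → 0 , λ _ _ _ _ → ∣p-p∣<ε p 0<ε)

fromℕ : ℕ → ℝ
fromℕ n = fromℚ ((+ n) ℚ./ 1)

0ℝ 1ℝ : ℝ
0ℝ = fromℚ 0ℚ
1ℝ = fromℚ 1ℚ

infixl 6 _+_
infixl 7 _*_ _÷_[_]
infix  8 -_

_+_ : ℝ → ℝ → ℝ
x + y = mkℝ (λ n → seq x n ℚ.+ seq y n) λ ε 0<ε →
  let (N , p) = cauchy x (½ ℚ.* ε) (half-pos 0<ε)
      (M , q) = cauchy y (½ ℚ.* ε) (half-pos 0<ε)
  in N ℕ.⊔ M , λ m n h k → subst (_ ℚ.<_) (half+half ε)
       (∣+∣-close {seq x m} {seq y m} {seq x n} {seq y n}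
         (p m n (ℕ.m⊔n≤o⇒m≤o N M h) (ℕ.m⊔n≤o⇒m≤o N M k))
         (q m n (ℕ.m⊔n≤o⇒n≤o N M h) (ℕ.m⊔n≤o⇒n≤o N M k)))

-_ : ℝ → ℝ
- x = mkℝ (λ n → ℚ.- seq x n) λ ε 0<ε →
  let (N , p) = cauchy x ε 0<ε
  in N , λ m n h k → ∣-∣-close {seq x m} {seq x n} (p m n h k)

private
  bounded : ∀ x → ∃ λ B → 0ℚ ℚ.< B × ∃ λ N → ∀ n → N ℕ.≤ n → ∣ seq x n ∣ ℚ.< B
  bounded x with cauchy x 1ℚ 0<1
  ... | N , p = ∣ seq x N ∣ ℚ.+ 1ℚ , ℚ.≤-<-trans (ℚ.0≤∣p∣ (seq x N)) (p<p+1 _) , N , λ n h →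
    ℚ.≤-<-trans
      (subst (λ t → ∣ t ∣ ℚ.≤ ∣ seq x N ∣ ℚ.+ ∣ seq x n ℚ.- seq x N ∣)
        (solve 2 (λ a b → a :+ (b :- a) := b) refl (seq x N) (seq x n))
        (ℚ.∣p+q∣≤∣p∣+∣q∣ (seq x N) (seq x n ℚ.- seq x N)))
      (ℚ.+-monoʳ-< ∣ seq x N ∣ (p n N h ℕ.≤-refl))
    where open +-*-Solver using (solve; con; _:=_; _:+_; _:*_; _:-_; :-_)

  common-bound : ∀ x y → ∃ λ B → 0ℚ ℚ.< B × ∃ λ N → ∀ n → N ℕ.≤ n →
                 ∣ seq x n ∣ ℚ.< B × ∣ seq y n ∣ ℚ.< B
  common-bound x y = combine (bounded x) (bounded y)
    where
    combine : (∃ λ B → 0ℚ ℚ.< B × ∃ λ N → ∀ n → N ℕ.≤ n → ∣ seq x n ∣ ℚ.< B) →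
              (∃ λ B → 0ℚ ℚ.< B × ∃ λ N → ∀ n → N ℕ.≤ n → ∣ seq y n ∣ ℚ.< B) →
              ∃ λ B → 0ℚ ℚ.< B × ∃ λ N → ∀ n → N ℕ.≤ n → ∣ seq x n ∣ ℚ.< B × ∣ seq y n ∣ ℚ.< B
    combine (B , 0<B , N , p) (C , 0<C , M , q) =
      B ℚ.+ C , ℚ.<-≤-trans 0<B (p≤p+q {B} {C} (ℚ.<⇒≤ 0<C)) , N ℕ.⊔ M , λ n h →
        ℚ.<-≤-trans (p n (ℕ.m⊔n≤o⇒m≤o N M h)) (p≤p+q {B} {C} (ℚ.<⇒≤ 0<C)) ,
        ℚ.<-≤-trans (q n (ℕ.m⊔n≤o⇒n≤o N M h))
          (subst (C ℚ.≤_) (ℚ.+-comm C B) (p≤p+q {C} {B} (ℚ.<⇒≤ 0<B)))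

_*_ : ℝ → ℝ → ℝ
x * y = mkℝ (λ n → seq x n ℚ.* seq y n) λ ε 0<ε →
  let (B , 0<B , K , b) = common-bound x y
      (δ , 0<δ , eq)    = scale 0<B 0<ε
      (N , p)           = cauchy x δ 0<δ
      (M , q)           = cauchy y δ 0<δ
      K≤ : ∀ {n} → K ℕ.⊔ (N ℕ.⊔ M) ℕ.≤ n → K ℕ.≤ n
      K≤ h = ℕ.m⊔n≤o⇒m≤o K (N ℕ.⊔ M) h
      N≤ : ∀ {n} → K ℕ.⊔ (N ℕ.⊔ M) ℕ.≤ n → N ℕ.≤ n
      N≤ h = ℕ.m⊔n≤o⇒m≤o N M (ℕ.m⊔n≤o⇒n≤o K (N ℕ.⊔ M) h)
      M≤ : ∀ {n} → K ℕ.⊔ (N ℕ.⊔ M) ℕ.≤ n → M ℕ.≤ n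
      M≤ h = ℕ.m⊔n≤o⇒n≤o N M (ℕ.m⊔n≤o⇒n≤o K (N ℕ.⊔ M) h)
  in K ℕ.⊔ (N ℕ.⊔ M) , λ m n h k → subst (_ ℚ.<_) eq
       (∣*∣-close {seq x m} {seq y m} {seq x n} {seq y n} 0<B
         (proj₁ (b m (K≤ h))) (proj₂ (b n (K≤ k)))
         (p m n (N≤ h) (N≤ k)) (q m n (M≤ h) (M≤ k)))

private
  +-cong : ∀ {x x′ y y′} → x ≃ x′ → y ≃ y′ → x + y ≃ x′ + y′
  +-cong {x} {x′} {y} {y′} x≃ y≃ ε 0<ε
    with x≃ (½ ℚ.* ε) (half-pos 0<ε) | y≃ (½ ℚ.* ε) (half-pos 0<ε)
  ... | N , p | M , q = N ℕ.⊔ M , λ n h → subst (_ ℚ.<_) (half+half ε)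
    (∣+∣-close {seq x n} {seq y n} {seq x′ n} {seq y′ n}
      (p n (ℕ.m⊔n≤o⇒m≤o N M h)) (q n (ℕ.m⊔n≤o⇒n≤o N M h)))

  -‿cong : ∀ {x y} → x ≃ y → - x ≃ - y
  -‿cong {x} {y} x≃y ε 0<ε with x≃y ε 0<ε
  ... | N , p = N , λ n h → ∣-∣-close {seq x n} {seq y n} (p n h)

  *-cong : ∀ {x x′ y y′} → x ≃ x′ → y ≃ y′ → x * y ≃ x′ * y′
  *-cong {x} {x′} {y} {y′} x≃ y≃ ε 0<ε =
    let (B , 0<B , K , b) = common-bound x y′
        (δ , 0<δ , eq)    = scale {B} {ε} 0<B 0<ε
        (N , p)           = x≃ δ 0<δ
        (M , q)           = y≃ δ 0<δ
        NM≤ : ∀ {n} → K ℕ.⊔ (N ℕ.⊔ M) ℕ.≤ n → N ℕ.⊔ M ℕ.≤ n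
        NM≤ h = ℕ.m⊔n≤o⇒n≤o K (N ℕ.⊔ M) h
        K≤ : ∀ {n} → K ℕ.⊔ (N ℕ.⊔ M) ℕ.≤ n → K ℕ.≤ n
        K≤ h = ℕ.m⊔n≤o⇒m≤o K (N ℕ.⊔ M) h
    in K ℕ.⊔ (N ℕ.⊔ M) , λ n h → subst (_ ℚ.<_) eq
         (∣*∣-close {seq x n} {seq y n} {seq x′ n} {seq y′ n} 0<B
           (proj₁ (b n (K≤ h))) (proj₂ (b n (K≤ h)))
           (p n (ℕ.m⊔n≤o⇒m≤o N M (NM≤ h))) (q n (ℕ.m⊔n≤o⇒n≤o N M (NM≤ h))))

ℝ-commutativeRing : CommutativeRing 0ℓ 0ℓ
ℝ-commutativeRing = record
  { Carrier = ℝ ; _≈_ = _≃_ ; _+_ = _+_ ; _*_ = _*_ ; -_ = -_ ; 0# = 0ℝ ; 1# = 1ℝ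
  ; isCommutativeRing = record
    { isRing = record
      { +-isAbelianGroup = record
        { isGroup = record
          { isMonoid = record
            { isSemigroup = record
              { isMagma = record
                { isEquivalence = record
                  { refl  = λ {x} → ≃-refl {x}
                  ; sym   = λ {x} {y} → ≃-sym {x} {y}
                  ; trans = λ {x} {y} {z} → ≃-trans {x} {y} {z}
                  }
                ; ∙-cong = λ {x} {x′} {y} {y′} → +-cong {x} {x′} {y} {y′}
                }
              ; assoc = λ x y z → ≃-pointwise {(x + y) + z} {x + (y + z)}
                  λ n → ℚ.+-assoc (seq x n) (seq y n) (seq z n)
              }
            ; identity = (λ x → ≃-pointwise {0ℝ + x} {x} λ n → ℚ.+-identityˡ (seq x n))
                       , (λ x → ≃-pointwise {x + 0ℝ} {x} λ n → ℚ.+-identityʳ (seq x n))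
            }
          ; inverse = (λ x → ≃-pointwise {(- x) + x} {0ℝ} λ n → ℚ.+-inverseˡ (seq x n))
                    , (λ x → ≃-pointwise {x + (- x)} {0ℝ} λ n → ℚ.+-inverseʳ (seq x n))
          ; ⁻¹-cong = λ {x} {y} → -‿cong {x} {y}
          }
        ; comm = λ x y → ≃-pointwise {x + y} {y + x} λ n → ℚ.+-comm (seq x n) (seq y n)
        }
      ; *-cong = λ {x} {x′} {y} {y′} → *-cong {x} {x′} {y} {y′}
      ; *-assoc = λ x y z → ≃-pointwise {(x * y) * z} {x * (y * z)}
          λ n → ℚ.*-assoc (seq x n) (seq y n) (seq z n)
      ; *-identity = (λ x → ≃-pointwise {1ℝ * x} {x} λ n → ℚ.*-identityˡ (seq x n))
                   , (λ x → ≃-pointwise {x * 1ℝ} {x} λ n → ℚ.*-identityʳ (seq x n))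
      ; distrib = (λ x y z → ≃-pointwise {x * (y + z)} {x * y + x * z}
                    λ n → ℚ.*-distribˡ-+ (seq x n) (seq y n) (seq z n))
                , (λ x y z → ≃-pointwise {(y + z) * x} {y * x + z * x}
                    λ n → ℚ.*-distribʳ-+ (seq x n) (seq y n) (seq z n))
      }
    ; *-comm = λ x y → ≃-pointwise {x * y} {y * x} λ n → ℚ.*-comm (seq x n) (seq y n)
    }
  }

private
  ℝ-rawSemiring : RawSemiring 0ℓ 0ℓ
  ℝ-rawSemiring = Semiring.rawSemiring (CommutativeRing.semiring ℝ-commutativeRing)

open import Algebra.Definitions.RawSemiring ℝ-rawSemiring public using (_^_)
open import Algebra.Definitions.RawMonoid (RawSemiring.*-rawMonoid ℝ-rawSemiring) public
  using () renaming (sum to ∏)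

∑ : ∀ {A : Set} → List A → (A → ℝ) → ℝ
∑ xs f = foldr _+_ 0ℝ (map f xs)

syntax ∑ xs (λ x → e) = ∑[ x ∈ xs ] e

-- Apartness from zero, the constructive form of x ≠ 0.
_#0 : ℝ → Set
x #0 = ∃ λ δ → 0ℚ ℚ.< δ × ∃ λ N → ∀ n → N ℕ.≤ n → δ ℚ.≤ ∣ seq x n ∣

-- Zero terms of the sequence are sent to zero; if x #0 this affects only
-- finitely many terms.
invℚ : ℚ → ℚ
invℚ p with p ℚ.≟ 0ℚ
... | yes _   = 0ℚ
... | no  p≢0 = ℚ.1/_ p {{ℚ.≢-nonZero p≢0}}

invℚ-inverse : ∀ {p} → p ≢ 0ℚ → invℚ p ℚ.* p ≡ 1ℚ
invℚ-inverse {p} p≢0 with p ℚ.≟ 0ℚ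
... | yes p≡0 = contradiction p≡0 p≢0
... | no  q   = ℚ.*-inverseˡ p {{ℚ.≢-nonZero q}}

private
  ≤∣∣⇒≢0 : ∀ {δ p} → 0ℚ ℚ.< δ → δ ℚ.≤ ∣ p ∣ → p ≢ 0ℚ
  ≤∣∣⇒≢0 0<δ δ≤ refl = ℚ.<-irrefl refl (ℚ.<-≤-trans 0<δ δ≤)

  inv-close : ∀ {p q δ ε} → 0ℚ ℚ.< δ → 0ℚ ℚ.< ε → δ ℚ.≤ ∣ p ∣ → δ ℚ.≤ ∣ q ∣ →
              ∣ p ℚ.- q ∣ ℚ.< ε ℚ.* (δ ℚ.* δ) → ∣ invℚ p ℚ.- invℚ q ∣ ℚ.< ε
  inv-close {p} {q} {δ} {ε} 0<δ 0<ε δ≤p δ≤q h =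
    ℚ.*-cancelʳ-<-nonNeg (∣ p ∣ ℚ.* ∣ q ∣) {{ℚ.nonNegative (*-nonneg (ℚ.0≤∣p∣ p) (ℚ.0≤∣p∣ q))}}
      (subst (ℚ._< ε ℚ.* (∣ p ∣ ℚ.* ∣ q ∣)) (≡.sym eq)
        (ℚ.<-≤-trans h (*-monoˡ (ℚ.<⇒≤ 0<ε) (*-mono (ℚ.0≤∣p∣ p) (ℚ.<⇒≤ 0<δ) δ≤p δ≤q))))
    where
    open +-*-Solver using (solve; _:=_; _:+_; _:*_; _:-_)
    inner : (invℚ p ℚ.- invℚ q) ℚ.* (p ℚ.* q) ≡ q ℚ.- p
    inner = ≡.trans
      (solve 4 (λ a b p q → (a :- b) :* (p :* q) := (a :* p) :* q :- (b :* q) :* p) refl (invℚ p) (invℚ q) p q)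
      (cong₂ ℚ._-_
        (≡.trans (cong (ℚ._* q) (invℚ-inverse (≤∣∣⇒≢0 0<δ δ≤p))) (ℚ.*-identityˡ q))
        (≡.trans (cong (ℚ._* p) (invℚ-inverse (≤∣∣⇒≢0 0<δ δ≤q))) (ℚ.*-identityˡ p)))
    eq : ∣ invℚ p ℚ.- invℚ q ∣ ℚ.* (∣ p ∣ ℚ.* ∣ q ∣) ≡ ∣ p ℚ.- q ∣
    eq = ≡.trans (cong (∣ invℚ p ℚ.- invℚ q ∣ ℚ.*_) (≡.sym (ℚ.∣p*q∣≡∣p∣*∣q∣ p q)))
      (≡.trans (≡.sym (ℚ.∣p*q∣≡∣p∣*∣q∣ (invℚ p ℚ.- invℚ q) (p ℚ.* q)))
        (≡.trans (cong ∣_∣ inner) (∣p-q∣≡∣q-p∣ q p)))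

recip : (x : ℝ) → x #0 → ℝ
recip x (δ , 0<δ , K , d) = mkℝ (invℚ ∘ seq x) λ ε 0<ε →
  let (N , p) = cauchy x (ε ℚ.* (δ ℚ.* δ)) (*-pos 0<ε (*-pos 0<δ 0<δ))
  in K ℕ.⊔ N , λ m n h k → inv-close 0<δ 0<ε
       (d m (ℕ.m⊔n≤o⇒m≤o K N h)) (d n (ℕ.m⊔n≤o⇒m≤o K N k))
       (p m n (ℕ.m⊔n≤o⇒n≤o K N h) (ℕ.m⊔n≤o⇒n≤o K N k))

recip-inverse : ∀ x (x#0 : x #0) → recip x x#0 * x ≃ 1ℝ
recip-inverse x (δ , 0<δ , K , d) ε 0<ε = K , λ n h →
  subst (λ t → ∣ t ℚ.- 1ℚ ∣ ℚ.< ε) (≡.sym (invℚ-inverse (≤∣∣⇒≢0 0<δ (d n h)))) (∣p-p∣<ε 1ℚ 0<ε)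

_÷_[_] : (x y : ℝ) → y #0 → ℝ
x ÷ y [ y#0 ] = x * recip y y#0

fromℕ#0 : ∀ n → .{{_ : ℕ.NonZero n}} → fromℕ n #0
fromℕ#0 n = p , 0<p , 0 , λ _ _ → ℚ.≤-reflexive (≡.sym (ℚ.0≤p⇒∣p∣≡p (ℚ.<⇒≤ 0<p)))
  where
  p : ℚ
  p = (+ n) ℚ./ 1
  0<p : 0ℚ ℚ.< p
  0<p = ℚ.positive⁻¹ p {{ℚ.normalize-pos n 1}}

*#0 : ∀ x y → x #0 → y #0 → (x * y) #0
*#0 x y (δ , 0<δ , N , p) (ε , 0<ε , M , q) = δ ℚ.* ε , *-pos 0<δ 0<ε , N ℕ.⊔ M , λ n h →
  subst (δ ℚ.* ε ℚ.≤_) (≡.sym (ℚ.∣p*q∣≡∣p∣*∣q∣ (seq x n) (seq y n)))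
    (*-mono (ℚ.0≤∣p∣ (seq x n)) (ℚ.<⇒≤ 0<ε) (p n (ℕ.m⊔n≤o⇒m≤o N M h)) (q n (ℕ.m⊔n≤o⇒n≤o N M h)))

∏#0 : (f : Fin n → ℝ) → (∀ k → f k #0) → ∏ f #0
∏#0 {zero}  f f#0 = 1ℚ , 0<1 , 0 , λ _ _ → ℚ.≤-refl
∏#0 {suc n} f f#0 = *#0 (f zero) (∏ (f ∘ suc)) (f#0 zero) (∏#0 (f ∘ suc) (f#0 ∘ suc))

-- The real number ∑ₙ a n is the class of its sequence of partial sums.
∑∞ : (a : ℕ → ℚ) → Cauchy (λ N → ∑< N a) → ℝ
∑∞ a = mkℝ (λ N → ∑< N a)

data Admissible : List ℕ → Set where
  _∷_ : ∀ {s ss} → 2 ℕ.≤ s → All (1 ℕ.≤_) ss → Admissible (s ∷ ss)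

ζ : (s : List ℕ) → Admissible s → ℝ
ζ (s ∷ ss) (2≤s ∷ 1≤ss) = ∑∞ (mzvTerm s ss) (mzv-Cauchy 2≤s 1≤ss)

ζ₁ : (s : ℕ) → 2 ℕ.≤ s → ℝ
ζ₁ s 2≤s = ζ (s ∷ []) (2≤s ∷ [])

S : (i : Fin m → ℕ) (q : ℕ) → (∀ k → 1 ℕ.≤ i k) → 2 ℕ.≤ q → ℝ
S i q 1≤i 2≤q = ∑∞ (eulerTerm i q) (euler-Cauchy i q 1≤i 2≤q)

ζ₁#0 : ∀ s (2≤s : 2 ℕ.≤ s) → ζ₁ s 2≤s #0
ζ₁#0 s 2≤s = mzv (s ∷ []) 1 , 0<first , 1 , λ where
    (suc n) _ → subst (mzv (s ∷ []) 1 ℚ.≤_) (≡.sym (ℚ.0≤p⇒∣p∣≡p (mzv≥0 (s ∷ []) (suc n)))) (first≤ n)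
  where
  0<first : 0ℚ ℚ.< mzv (s ∷ []) 1
  0<first = subst (0ℚ ℚ.<_) (≡.sym (≡.trans (ℚ.+-identityˡ _) (ℚ.*-identityʳ _))) (power-pos 0 s)
  first≤ : ∀ n → mzv (s ∷ []) 1 ℚ.≤ mzv (s ∷ []) (suc n)
  first≤ zero    = ℚ.≤-refl
  first≤ (suc n) = ℚ.≤-trans (first≤ n) (p≤p+q (*-nonneg (power≥0 (suc n) s) 0≤1))

-- Each element of X occurs exactly once in elements, up to the equality of X,
-- so a sum over elements is the sum over X.
record Enumeration (X : Setoid 0ℓ 0ℓ) : Set where
  field
    elements : List (Setoid.Carrier X)
    complete : Enumerates.IsEnumeration X elements
    unique   : Unique.Unique X elements

open Enumeration public

-- Index choices 1 ≤ j₁ < ⋯ < jₗ ≤ m, with both positions and values numbered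
-- from 0.
record Increasing (l m : ℕ) : Set where
  field
    at   : Fin l → Fin m
    mono : ∀ {a b} → a Fin.< b → at a Fin.< at b

open Increasing public

increasingSetoid : ℕ → ℕ → Setoid 0ℓ 0ℓ
increasingSetoid l m = On.setoid (Fin l →-setoid Fin m) at

private
  none : Increasing 0 m
  none = record { at = λ () ; mono = λ { {()} } }

  skip : Increasing l m → Increasing l (suc m)
  skip j = record { at = suc ∘ at j ; mono = s≤s ∘ mono j }

  keep : Increasing l m → Increasing (suc l) (suc m)
  keep {l} {m} j = record { at = at′ ; mono = λ {a} {b} → mono′ a b }
    where
    at′ : Fin (suc l) → Fin (suc m)
    at′ zero    = zero
    at′ (suc a) = suc (at j a)
    mono′ : ∀ a b → a Fin.< b → at′ a Fin.< at′ b
    mono′ zero    (suc b) _         = s≤s z≤n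
    mono′ (suc a) (suc b) (s≤s a<b) = s≤s (mono j a<b)

increasingList : ∀ l m → List (Increasing l m)
increasingList zero    m       = none ∷ []
increasingList (suc l) zero    = []
increasingList (suc l) (suc m) = map keep (increasingList l m) ++ map skip (increasingList (suc l) m)

private
  positive⇒suc : (x : Fin (suc m)) → 0 ℕ.< Fin.toℕ x → ∃ λ y → x ≡ suc y
  positive⇒suc (suc y) _ = y , refl

  0<at-suc : (j : Increasing (suc l) (suc m)) → ∀ a → 0 ℕ.< Fin.toℕ (at j (suc a))
  0<at-suc j a = ℕ.≤-<-trans z≤n (mono j {zero} {suc a} (s≤s z≤n))

  unkeep : (j : Increasing (suc l) (suc m)) → ∃ λ (k : Increasing l m) → ∀ a → at j (suc a) ≡ suc (at k a)
  unkeep {l} {m} j = record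
    { at   = proj₁ ∘ pred
    ; mono = λ {a} {b} a<b → ℕ.≤-pred (subst₂ Fin._<_ (proj₂ (pred a)) (proj₂ (pred b)) (mono j (s≤s a<b)))
    } , proj₂ ∘ pred
    where
    pred : ∀ a → ∃ λ y → at j (suc a) ≡ suc y
    pred a = positive⇒suc (at j (suc a)) (0<at-suc j a)

  unskip : (j : Increasing (suc l) (suc m)) → ∀ {x} → at j zero ≡ suc x →
           ∃ λ (k : Increasing (suc l) m) → ∀ a → at j a ≡ suc (at k a)
  unskip {l} {m} j eq = record
    { at   = proj₁ ∘ pred
    ; mono = λ {a} {b} a<b → ℕ.≤-pred (subst₂ Fin._<_ (proj₂ (pred a)) (proj₂ (pred b)) (mono j a<b))
    } , proj₂ ∘ pred
    where
    pred : ∀ a → ∃ λ y → at j a ≡ suc y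
    pred zero    = _ , eq
    pred (suc a) = positive⇒suc (at j (suc a)) (0<at-suc j a)

  increasing-complete : ∀ l m → Enumerates.IsEnumeration (increasingSetoid l m) (increasingList l m)
  increasing-complete zero    m       j = here λ ()
  increasing-complete (suc l) zero    j with () ← at j zero
  increasing-complete (suc l) (suc m) j with at j zero in eq
  ... | zero  = let (k , j≈k) = unkeep j in
    Any.++⁺ˡ (Any.map⁺ (Any.map
      (λ k≈x → λ { zero → eq ; (suc a) → ≡.trans (j≈k a) (cong suc (k≈x a)) })
      (increasing-complete l m k)))
  ... | suc x = let (k , j≈k) = unskip j eq in
    Any.++⁺ʳ (map keep (increasingList l m)) (Any.map⁺ (Any.map
      (λ k≈x a → ≡.trans (j≈k a) (cong suc (k≈x a)))
      (increasing-complete (suc l) m k)))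

  increasing-unique : ∀ l m → Unique.Unique (increasingSetoid l m) (increasingList l m)
  increasing-unique zero    m       = [] ∷ []
  increasing-unique (suc l) zero    = []
  increasing-unique (suc l) (suc m) = Unique.++⁺ (increasingSetoid (suc l) (suc m))
    (Unique.map⁺ (increasingSetoid l m) (increasingSetoid (suc l) (suc m))
      {f = keep} (λ eq a → Fin.suc-injective (eq (suc a))) (increasing-unique l m))
    (Unique.map⁺ (increasingSetoid (suc l) m) (increasingSetoid (suc l) (suc m))
      {f = skip} (λ eq a → Fin.suc-injective (eq a)) (increasing-unique (suc l) m))
    λ (∈keep , ∈skip) →
      let (_ , eq)  = Any.satisfied (Any.map⁻ {xs = increasingList l m} ∈keep)
          (_ , eq′) = Any.satisfied (Any.map⁻ {xs = increasingList (suc l) m} ∈skip)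
      in Fin.0≢1+n (≡.trans (≡.sym (eq zero)) (eq′ zero))

increasing : ∀ l m → Enumeration (increasingSetoid l m)
increasing l m = record
  { elements = increasingList l m
  ; complete = increasing-complete l m
  ; unique   = increasing-unique l m
  }

record Composition (l : ℕ) : Set where
  field
    parts    : List ℕ
    positive : All (1 ℕ.≤_) parts
    total    : sum parts ≡ l

open Composition public

compositionSetoid : ℕ → Setoid 0ℓ 0ℓ
compositionSetoid l = On.setoid (≡.setoid (List ℕ)) (parts {l})

private
  empty : Composition 0
  empty = record { parts = [] ; positive = [] ; total = refl }

  cons-one : Composition l → Composition (suc l)
  cons-one η = record { parts = 1 ∷ parts η ; positive = ℕ.≤-refl ∷ positive η ; total = cong suc (total η) }

  grow : Composition (suc l) → Composition (suc (suc l))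
  grow record { parts = k ∷ ks ; positive = p ∷ ps ; total = t } =
    record { parts = suc k ∷ ks ; positive = ℕ.m≤n⇒m≤1+n p ∷ ps ; total = cong suc t }

compositionsList : ∀ l → List (Composition l)
compositionsList zero          = empty ∷ []
compositionsList (suc zero)    = cons-one empty ∷ []
compositionsList (suc (suc l)) = map cons-one (compositionsList (suc l)) ++ map grow (compositionsList (suc l))

private
  grow-parts : ∀ (η : Composition (suc l)) {k ks} → k ∷ ks ≡ parts η → suc k ∷ ks ≡ parts (grow η)
  grow-parts record { parts = _ ∷ _ ; positive = _ ∷ _ } refl = refl

  grow-injective : ∀ {η κ : Composition (suc l)} → parts (grow η) ≡ parts (grow κ) → parts η ≡ parts κ
  grow-injective {η = record { parts = _ ∷ _ ; positive = _ ∷ _ }} {record { parts = _ ∷ _ ; positive = _ ∷ _ }} refl = refl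

  cons-one≢grow : ∀ {η κ : Composition (suc l)} → parts (cons-one η) ≢ parts (grow κ)
  cons-one≢grow {κ = record { parts = suc _ ∷ _ ; positive = _ ∷ _ }} ()
  cons-one≢grow {κ = record { parts = zero ∷ _ ; positive = () ∷ _ }} _

  compositions-complete : ∀ l → Enumerates.IsEnumeration (compositionSetoid l) (compositionsList l)
  compositions-complete zero          record { parts = [] } = here refl
  compositions-complete zero          record { parts = zero ∷ _ ; positive = () ∷ _ }
  compositions-complete (suc zero)    record { parts = zero ∷ _ ; positive = () ∷ _ }
  compositions-complete (suc zero)    record { parts = suc zero ∷ [] } = here refl
  compositions-complete (suc zero)    record { parts = suc zero ∷ zero ∷ _ ; positive = _ ∷ () ∷ _ }
  compositions-complete (suc (suc l)) record { parts = zero ∷ _ ; positive = () ∷ _ }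
  compositions-complete (suc (suc l)) record { parts = suc zero ∷ ks ; positive = _ ∷ ps ; total = t } =
    Any.++⁺ˡ (Any.map⁺ (Any.map (cong (1 ∷_))
      (compositions-complete (suc l) record { parts = ks ; positive = ps ; total = ℕ.suc-injective t })))
  compositions-complete (suc (suc l)) record { parts = suc (suc k) ∷ ks ; positive = _ ∷ ps ; total = t } =
    Any.++⁺ʳ (map cons-one (compositionsList (suc l))) (Any.map⁺ (Any.map (λ {x} → grow-parts x)
      (compositions-complete (suc l)
        record { parts = suc k ∷ ks ; positive = s≤s z≤n ∷ ps ; total = ℕ.suc-injective t })))

  compositions-unique : ∀ l → Unique.Unique (compositionSetoid l) (compositionsList l)
  compositions-unique zero          = [] ∷ []
  compositions-unique (suc zero)    = [] ∷ []
  compositions-unique (suc (suc l)) = Unique.++⁺ (compositionSetoid (suc (suc l)))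
    (Unique.map⁺ (compositionSetoid (suc l)) (compositionSetoid (suc (suc l)))
      {f = cons-one} List.∷-injectiveʳ (compositions-unique (suc l)))
    (Unique.map⁺ (compositionSetoid (suc l)) (compositionSetoid (suc (suc l)))
      {f = grow} (λ {x} {y} → grow-injective {η = x} {y}) (compositions-unique (suc l)))
    λ (∈cons , ∈grow) →
      let (η , eq)  = Any.satisfied (Any.map⁻ {xs = compositionsList (suc l)} ∈cons)
          (κ , eq′) = Any.satisfied (Any.map⁻ {xs = compositionsList (suc l)} ∈grow)
      in cons-one≢grow {η = η} {κ} (≡.trans (≡.sym eq) eq′)

compositions : ∀ l → Enumeration (compositionSetoid l)
compositions l = record
  { elements = compositionsList l
  ; complete = compositions-complete l
  ; unique   = compositions-unique l
  }

permutationSetoid : ℕ → Setoid 0ℓ 0ℓ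
permutationSetoid l = On.setoid (Fin l →-setoid Fin l) (_⟨$⟩ʳ_ {l} {l})

permutationsList : ∀ l → List (Permutation′ l)
permutationsList zero    = Perm.id ∷ []
permutationsList (suc l) = cartesianProductWith (insert zero) (allFin (suc l)) (permutationsList l)

private
  insert-cong : ∀ {a b : Fin (suc l)} {π ρ : Permutation′ l} → a ≡ b → π Perm.≈ ρ →
                insert zero a π Perm.≈ insert zero b ρ
  insert-cong             refl π≈ρ zero    = refl
  insert-cong {a = a} {π = π} {ρ} refl π≈ρ (suc x) = ≡.trans (Perm.insert-punchIn zero a π x)
    (≡.trans (cong (Fin.punchIn a) (π≈ρ x)) (≡.sym (Perm.insert-punchIn zero a ρ x)))

  insert-injective : ∀ {a b : Fin (suc l)} {π ρ : Permutation′ l} →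
                     insert zero a π Perm.≈ insert zero b ρ → a ≡ b × π Perm.≈ ρ
  insert-injective {a = a} {π = π} {ρ} eq with refl ← eq zero = refl , λ x →
    Fin.punchIn-injective a (π ⟨$⟩ʳ x) (ρ ⟨$⟩ʳ x)
      (≡.trans (≡.sym (Perm.insert-punchIn zero a π x))
        (≡.trans (eq (suc x)) (Perm.insert-punchIn zero a ρ x)))

  permutations-complete : ∀ l → Enumerates.IsEnumeration (permutationSetoid l) (permutationsList l)
  permutations-complete zero    π = here λ ()
  permutations-complete (suc l) π =
    Membership.∈-resp-≈ (permutationSetoid (suc l)) {x = insert zero (π ⟨$⟩ʳ zero) (remove zero π)} {y = π}
      (Perm.insert-remove zero π)
      (Membership.∈-cartesianProductWith⁺ (≡.setoid (Fin (suc l))) (permutationSetoid l) (permutationSetoid (suc l))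
        {f = insert zero} (λ {a} {b} {π} {ρ} → insert-cong {a = a} {b} {π} {ρ})
        (MembershipP.∈-allFin (π ⟨$⟩ʳ zero)) (permutations-complete l (remove zero π)))

  permutations-unique : ∀ l → Unique.Unique (permutationSetoid l) (permutationsList l)
  permutations-unique zero    = [] ∷ []
  permutations-unique (suc l) =
    Unique.cartesianProductWith⁺ (≡.setoid (Fin (suc l))) (permutationSetoid l) (permutationSetoid (suc l))
      (insert zero) (λ {a} {b} {π} {ρ} → insert-injective {a = a} {b} {π} {ρ})
      (UniqueP.allFin⁺ (suc l)) (permutations-unique l)

permutations : ∀ l → Enumeration (permutationSetoid l)
permutations l = record
  { elements = permutationsList l
  ; complete = permutations-complete l
  ; unique   = permutations-unique l
  }

-- blocks (η₁ ∷ ⋯ ∷ ηₚ ∷ []) cuts a list into consecutive blocks of lengths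
-- η₁, …, ηₚ: the c-th block holds the entries at (1-based) positions
-- η₁ + ⋯ + η_{c-1} + 1, …, η₁ + ⋯ + η_c.
blocks : ∀ {A : Set} → List ℕ → List A → List (List A)
blocks []       xs = []
blocks (k ∷ ks) xs = take k xs ∷ blocks ks (drop k xs)

J̃ : (Fin m → ℕ) → Increasing l m → Composition l → Permutation′ l → List ℕ
J̃ i j η τ = map sum (blocks (parts η) (tabulate λ r → i (at j (τ ⟨$⟩ʳ r))))

private
  block-sums≥2 : ∀ ks (vs : List ℕ) → All (1 ℕ.≤_) ks → sum ks ≡ List.length vs → All (2 ℕ.≤_) vs →
                 All (2 ℕ.≤_) (map sum (blocks ks vs))
  block-sums≥2 []           vs       []       eq 2≤vs = []
  block-sums≥2 (suc k ∷ ks) (v ∷ vs) (_ ∷ ps) eq (2≤v ∷ 2≤vs) =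
    ℕ.≤-trans 2≤v (ℕ.m≤m+n v _) ∷ block-sums≥2 ks (drop k vs) ps
      (≡.sym (≡.trans (List.length-drop k vs)
        (≡.trans (cong (ℕ._∸ k) (≡.sym (ℕ.suc-injective eq))) (ℕ.m+n∸m≡n k (sum ks)))))
      (All.drop⁺ k 2≤vs)

J̃-admissible : ∀ {i : Fin m → ℕ} {q} → (∀ k → 2 ℕ.≤ i k) → 2 ℕ.≤ q →
               (j : Increasing l m) (η : Composition l) (τ : Permutation′ l) →
               Admissible (J̃ i j η τ ++ q ∷ [])
J̃-admissible {i = i} 2≤i 2≤q j η τ = admissible (J̃ i j η τ)
  (block-sums≥2 (parts η) values (positive η)
    (≡.trans (total η) (≡.sym (List.length-tabulate _)))
    (All.tabulate⁺ λ r → 2≤i (at j (τ ⟨$⟩ʳ r))))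
  where
  values : List ℕ
  values = tabulate λ r → i (at j (τ ⟨$⟩ʳ r))
  admissible : ∀ ss → All (2 ℕ.≤_) ss → Admissible (ss ++ _ ∷ [])
  admissible []       []       = 2≤q ∷ []
  admissible (s ∷ ss) (p ∷ ps) = p ∷ All.++⁺ (All.map ℕ.<⇒≤ ps) (ℕ.<⇒≤ 2≤q ∷ [])

factorials : List ℕ → ℕ
factorials ks = product (map _! ks)

factorials≢0 : ∀ ks → ℕ.NonZero (factorials ks)
factorials≢0 []       = _
factorials≢0 (k ∷ ks) = ℕ.m*n≢0 (k !) (factorials ks) {{k ℕ.!≢0}} {{factorials≢0 ks}}

module Submission where

-- The identity already holds for the partial sums up to any N ≥ 1.  Write
-- H s (n + 1) = H s N − T s n, where T s n is the sum of a⁻ˢ over n + 1 < a ≤ N;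
-- expanding the product of these differences gives the alternating sum over index
-- choices.  The sum of (n + 1)^(−q) ∏ T s n is a sum over the weak orderings of the
-- summation variables of the factors T.  It is matched, by induction on N, with the
-- sum over compositions and permutations: both sides grow by taking out the
-- variables equal to N + 1, and those form the first block η₁, whose η₁ ! orders
-- are compensated by 1 / η₁ !.

module Truncated where

  open import Data.Fin.Base as Fin using (Fin; zero; suc)
  open import Data.Fin.Permutation as Perm using (Permutation′; _⟨$⟩ʳ_; insert)
  open import Data.List.Base using (List; []; _∷_; _++_; map; foldr; take; drop; concatMap; length; tabulate; upTo; allFin; cartesianProductWith)
  import Data.List.Properties as List
  open import Data.List.Relation.Unary.All as All using (All; []; _∷_)
  import Data.List.Relation.Unary.All.Properties as All
  open import Data.Nat.Base as ℕ using (ℕ; zero; suc; s≤s; _!; _∸_)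
  open import Data.Nat.ListAction using (sum)
  import Data.Nat.Properties as ℕ
  open import Data.Product.Base using (_×_; _,_; map₁; map₂; proj₁; proj₂)
  open import Data.Rational.Base using (ℚ; 0ℚ; 1ℚ; _+_; _*_; _-_; -_)
  import Data.Rational.Properties as ℚ
  open import Algebra.Definitions.RawSemiring ℚ.+-*-rawSemiring using (_^_)
  open import Data.Rational.Solver using (module +-*-Solver)
  open import Defs using (∑<; mzv; H; 1/[1+_]^_; ∏ℚ; eulerTerm; invℚ; invℚ-inverse; factorials; factorials≢0; blocks; Composition; parts; positive; total; compositionsList; Increasing; at; increasingList; permutationsList)
  open import Defs using (module Convergence)
  open Convergence using (⟦_⟧; ∑<-cong; powers; r-inverse) renaming (r to 1/suc)
  open import Function.Base using (_∘_; id)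
  open import Relation.Binary.PropositionalEquality
  open +-*-Solver using (solve; con; _:=_; _:+_; _:*_; _:-_; :-_)
  open ≡-Reasoning

  private
    variable
      A B : Set

  -- Finite sums and products over lists

  ∑ˡ ∏ˡ : List A → (A → ℚ) → ℚ
  ∑ˡ xs f = foldr _+_ 0ℚ (map f xs)
  ∏ˡ xs f = foldr _*_ 1ℚ (map f xs)

  syntax ∑ˡ xs (λ x → e) = ∑ˡ[ x ∈ xs ] e

  ∑ˡ-cong-All : ∀ {f g : A → ℚ} {xs} → All (λ x → f x ≡ g x) xs → ∑ˡ xs f ≡ ∑ˡ xs g
  ∑ˡ-cong-All []       = refl
  ∑ˡ-cong-All (p ∷ ps) = cong₂ _+_ p (∑ˡ-cong-All ps)

  ∑ˡ-cong : ∀ {f g : A → ℚ} xs → (∀ x → f x ≡ g x) → ∑ˡ xs f ≡ ∑ˡ xs g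
  ∑ˡ-cong xs f≡g = ∑ˡ-cong-All (All.universal f≡g xs)

  ∑ˡ-map : ∀ (h : A → B) (f : B → ℚ) xs → ∑ˡ (map h xs) f ≡ ∑ˡ xs (f ∘ h)
  ∑ˡ-map h f xs = cong (foldr _+_ 0ℚ) (sym (List.map-∘ xs))

  ∑ˡ-++ : ∀ (f : A → ℚ) xs ys → ∑ˡ (xs ++ ys) f ≡ ∑ˡ xs f + ∑ˡ ys f
  ∑ˡ-++ f []       ys = sym (ℚ.+-identityˡ _)
  ∑ˡ-++ f (x ∷ xs) ys = trans (cong (f x +_) (∑ˡ-++ f xs ys)) (sym (ℚ.+-assoc (f x) _ _))

  ∑ˡ-map-++ : ∀ {C : Set} (h : A → C) (k : B → C) (f : C → ℚ) xs ys →
              ∑ˡ (map h xs ++ map k ys) f ≡ ∑ˡ xs (f ∘ h) + ∑ˡ ys (f ∘ k)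
  ∑ˡ-map-++ h k f xs ys = trans (∑ˡ-++ f (map h xs) (map k ys)) (cong₂ _+_ (∑ˡ-map h f xs) (∑ˡ-map k f ys))

  ∑ˡ-concatMap : ∀ (h : A → List B) (f : B → ℚ) xs → ∑ˡ (concatMap h xs) f ≡ ∑ˡ[ x ∈ xs ] ∑ˡ (h x) f
  ∑ˡ-concatMap h f []       = refl
  ∑ˡ-concatMap h f (x ∷ xs) = trans (∑ˡ-++ f (h x) (concatMap h xs)) (cong (∑ˡ (h x) f +_) (∑ˡ-concatMap h f xs))

  ∑ˡ-+ : ∀ (f g : A → ℚ) xs → ∑ˡ[ x ∈ xs ] (f x + g x) ≡ ∑ˡ xs f + ∑ˡ xs g
  ∑ˡ-+ f g []       = refl
  ∑ˡ-+ f g (x ∷ xs) = trans (cong (f x + g x +_) (∑ˡ-+ f g xs))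
    (solve 4 (λ a b c d → (a :+ b) :+ (c :+ d) := (a :+ c) :+ (b :+ d)) refl (f x) (g x) (∑ˡ xs f) (∑ˡ xs g))

  *-∑ˡ : ∀ c (f : A → ℚ) xs → c * ∑ˡ xs f ≡ ∑ˡ[ x ∈ xs ] (c * f x)
  *-∑ˡ c f []       = ℚ.*-zeroʳ c
  *-∑ˡ c f (x ∷ xs) = trans (ℚ.*-distribˡ-+ c (f x) _) (cong (c * f x +_) (*-∑ˡ c f xs))

  ∑ˡ-zero : ∀ (xs : List A) → ∑ˡ[ x ∈ xs ] 0ℚ ≡ 0ℚ
  ∑ˡ-zero []       = refl
  ∑ˡ-zero (x ∷ xs) = trans (ℚ.+-identityˡ _) (∑ˡ-zero xs)

  ∑ˡ-∑< : ∀ (a : A → ℕ → ℚ) xs N → ∑ˡ[ x ∈ xs ] ∑< N (a x) ≡ ∑< N (λ n → ∑ˡ[ x ∈ xs ] a x n)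
  ∑ˡ-∑< a xs zero    = ∑ˡ-zero xs
  ∑ˡ-∑< a xs (suc N) = trans (∑ˡ-+ (λ x → ∑< N (a x)) (λ x → a x N) xs)
    (cong (_+ ∑ˡ xs (λ x → a x N)) (∑ˡ-∑< a xs N))

  *-∑< : ∀ c (a : ℕ → ℚ) N → c * ∑< N a ≡ ∑< N (λ n → c * a n)
  *-∑< c a zero    = ℚ.*-zeroʳ c
  *-∑< c a (suc N) = trans (ℚ.*-distribˡ-+ c _ _) (cong (_+ c * a N) (*-∑< c a N))

  ∑ˡ-upTo-suc : ∀ (f : ℕ → ℚ) n → ∑ˡ (upTo (suc n)) f ≡ f 0 + ∑ˡ (upTo n) (f ∘ suc)
  ∑ˡ-upTo-suc f n = cong (f 0 +_) (trans (cong (λ xs → ∑ˡ xs f) (sym (List.map-upTo suc n))) (∑ˡ-map suc f (upTo n)))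

  upTo-< : ∀ n → All (ℕ._< n) (upTo n)
  upTo-< n = All.applyUpTo⁺₁ id n id

  ∏ˡ-cong : ∀ {f g : A → ℚ} xs → (∀ x → f x ≡ g x) → ∏ˡ xs f ≡ ∏ˡ xs g
  ∏ˡ-cong []       f≡g = refl
  ∏ˡ-cong (x ∷ xs) f≡g = cong₂ _*_ (f≡g x) (∏ˡ-cong xs f≡g)

  ∏ˡ-tabulate : ∀ {n} (f : Fin n → A) (g : A → ℚ) → ∏ˡ (tabulate f) g ≡ ∏ℚ (g ∘ f)
  ∏ˡ-tabulate {n = zero}  f g = refl
  ∏ˡ-tabulate {n = suc n} f g = cong (g (f zero) *_) (∏ˡ-tabulate (f ∘ suc) g)

  -- Sublists with their remainders, and arrangements

  -- The second component of a pair in selections, choose and splits lists the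
  -- entries left over.
  selections : List A → List (A × List A)
  selections []      = []
  selections (x ∷ v) = (x , v) ∷ map (map₂ (x ∷_)) (selections v)

  choose : ℕ → List A → List (List A × List A)
  choose zero    v       = ([] , v) ∷ []
  choose (suc k) []      = []
  choose (suc k) (x ∷ v) = map (map₁ (x ∷_)) (choose k v) ++ map (map₂ (x ∷_)) (choose (suc k) v)

  splits : List A → List (List A × List A)
  splits []      = ([] , []) ∷ []
  splits (x ∷ v) = map (map₁ (x ∷_)) (splits v) ++ map (map₂ (x ∷_)) (splits v)

  -- Entries count by position: even with repeated values there are `length v !` arrangements of
  -- full length, which matches a sum over all permutations.
  arrangements : ℕ → List A → List (List A)
  arrangements zero    v = [] ∷ []
  arrangements (suc l) v = concatMap (λ (a , r) → map (a ∷_) (arrangements l r)) (selections v)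

  choose-length : ∀ k (v : List A) → All (λ (b , r) → length b ≡ k × k ℕ.+ length r ≡ length v) (choose k v)
  choose-length zero    v       = (refl , refl) ∷ []
  choose-length (suc k) []      = []
  choose-length (suc k) (x ∷ v) = All.++⁺
    (All.map⁺ (All.map (λ (p , q) → cong suc p , cong suc q) (choose-length k v)))
    (All.map⁺ (All.map (λ (p , q) → p , trans (ℕ.+-suc (suc k) _) (cong suc q)) (choose-length (suc k) v)))

  ∑-choose-suc : ∀ k (x : A) v (h : List A × List A → ℚ) →
    ∑ˡ (choose (suc k) (x ∷ v)) h ≡ ∑ˡ (choose k v) (h ∘ map₁ (x ∷_)) + ∑ˡ (choose (suc k) v) (h ∘ map₂ (x ∷_))
  ∑-choose-suc k x v h = ∑ˡ-map-++ (map₁ (x ∷_)) (map₂ (x ∷_)) h (choose k v) (choose (suc k) v)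

  -- Any bound `n` on the length will do, since `choose k v` is empty for `k` above the length. The
  -- induction needs this slack: sublists containing `x` use the hypothesis with `n`, the others
  -- with `n + 1`.
  ∑-splits-by-size : ∀ (v : List A) {n} → length v ℕ.≤ n → (h : List A × List A → ℚ) →
                     ∑ˡ (splits v) h ≡ ∑ˡ[ k ∈ upTo (suc n) ] ∑ˡ (choose k v) h
  ∑-splits-by-size [] {n} _ h = sym (trans (∑ˡ-upTo-suc (λ k → ∑ˡ (choose k []) h) n)
    (trans (cong (h ([] , []) + 0ℚ +_) (∑ˡ-zero (upTo n))) (ℚ.+-identityʳ _)))
  ∑-splits-by-size (x ∷ v) {suc n} (s≤s v≤n) h = begin
    ∑ˡ (splits (x ∷ v)) h
      ≡⟨ ∑ˡ-map-++ (map₁ (x ∷_)) (map₂ (x ∷_)) h (splits v) (splits v) ⟩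
    ∑ˡ (splits v) h₁ + ∑ˡ (splits v) h₂
      ≡⟨ cong₂ _+_ (∑-splits-by-size v v≤n h₁) (∑-splits-by-size v (ℕ.m≤n⇒m≤1+n v≤n) h₂) ⟩
    ∑ˡ[ k ∈ upTo (suc n) ] ∑ˡ (choose k v) h₁ + ∑ˡ[ k ∈ upTo (suc (suc n)) ] ∑ˡ (choose k v) h₂
      ≡⟨ cong (∑ˡ (upTo (suc n)) (λ k → ∑ˡ (choose k v) h₁) +_) (∑ˡ-upTo-suc (λ k → ∑ˡ (choose k v) h₂) (suc n)) ⟩
    ∑ˡ[ k ∈ upTo (suc n) ] ∑ˡ (choose k v) h₁ + (h₀ + ∑ˡ[ k ∈ upTo (suc n) ] ∑ˡ (choose (suc k) v) h₂)
      ≡⟨ solve 3 (λ a b c → a :+ (b :+ c) := b :+ (a :+ c)) refl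
           (∑ˡ (upTo (suc n)) (λ k → ∑ˡ (choose k v) h₁)) h₀ (∑ˡ (upTo (suc n)) (λ k → ∑ˡ (choose (suc k) v) h₂)) ⟩
    h₀ + (∑ˡ[ k ∈ upTo (suc n) ] ∑ˡ (choose k v) h₁ + ∑ˡ[ k ∈ upTo (suc n) ] ∑ˡ (choose (suc k) v) h₂)
      ≡⟨ cong (h₀ +_) (∑ˡ-+ (λ k → ∑ˡ (choose k v) h₁) (λ k → ∑ˡ (choose (suc k) v) h₂) (upTo (suc n))) ⟨
    h₀ + ∑ˡ[ k ∈ upTo (suc n) ] (∑ˡ (choose k v) h₁ + ∑ˡ (choose (suc k) v) h₂)
      ≡⟨ cong (h₀ +_) (∑ˡ-cong (upTo (suc n)) λ k → ∑-choose-suc k x v h) ⟨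
    h₀ + ∑ˡ[ k ∈ upTo (suc n) ] ∑ˡ (choose (suc k) (x ∷ v)) h
      ≡⟨ ∑ˡ-upTo-suc (λ k → ∑ˡ (choose k (x ∷ v)) h) (suc n) ⟨
    ∑ˡ[ k ∈ upTo (suc (suc n)) ] ∑ˡ (choose k (x ∷ v)) h ∎
    where
    h₁ h₂ : List _ × List _ → ℚ
    h₁ = h ∘ map₁ (x ∷_)
    h₂ = h ∘ map₂ (x ∷_)
    h₀ : ℚ
    h₀ = h ([] , x ∷ v) + 0ℚ

  -- Distributivity: the first half of a split collects the factors that contribute `f`, the second
  -- half those that contribute `g`.
  ∏-+ : ∀ (f g : A → ℚ) v → ∏ˡ v (λ x → f x + g x) ≡ ∑ˡ[ s ∈ splits v ] (∏ˡ (proj₁ s) f * ∏ˡ (proj₂ s) g)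
  ∏-+ f g []      = refl
  ∏-+ f g (x ∷ v) = begin
    (f x + g x) * ∏ˡ v (λ y → f y + g y)
      ≡⟨ cong ((f x + g x) *_) (∏-+ f g v) ⟩
    (f x + g x) * ∑ˡ (splits v) h
      ≡⟨ ℚ.*-distribʳ-+ (∑ˡ (splits v) h) (f x) (g x) ⟩
    f x * ∑ˡ (splits v) h + g x * ∑ˡ (splits v) h
      ≡⟨ cong₂ _+_ (*-∑ˡ (f x) h (splits v)) (*-∑ˡ (g x) h (splits v)) ⟩
    ∑ˡ[ s ∈ splits v ] (f x * h s) + ∑ˡ[ s ∈ splits v ] (g x * h s)
      ≡⟨ cong₂ _+_
           (∑ˡ-cong (splits v) λ (b , r) → sym (ℚ.*-assoc (f x) (∏ˡ b f) (∏ˡ r g)))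
           (∑ˡ-cong (splits v) λ (b , r) →
             solve 3 (λ c p q → c :* (p :* q) := p :* (c :* q)) refl (g x) (∏ˡ b f) (∏ˡ r g)) ⟩
    ∑ˡ (splits v) (h ∘ map₁ (x ∷_)) + ∑ˡ (splits v) (h ∘ map₂ (x ∷_))
      ≡⟨ ∑ˡ-map-++ (map₁ (x ∷_)) (map₂ (x ∷_)) h (splits v) (splits v) ⟨
    ∑ˡ (splits (x ∷ v)) h ∎
    where
    h : List _ × List _ → ℚ
    h (b , r) = ∏ˡ b f * ∏ˡ r g

  -- Weighted sums over chosen sublists

  module _ (f : A → ℚ) where

    selected : (List A → ℚ) → List A → ℚ
    selected φ v = ∑ˡ[ (a , r) ∈ selections v ] (f a * φ r)

    -- With `φ` constantly 1 this is the `k`-th elementary symmetric polynomial in the values of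
    -- `f`; a general `φ` lets the entries left over be processed further.
    chosen : ℕ → (List A → ℚ) → List A → ℚ
    chosen k φ v = ∑ˡ[ (b , r) ∈ choose k v ] (∏ˡ b f * φ r)

    selected-∷ : ∀ φ x v → selected φ (x ∷ v) ≡ f x * φ v + selected (φ ∘ (x ∷_)) v
    selected-∷ φ x v = cong (f x * φ v +_) (∑ˡ-map (map₂ (x ∷_)) _ (selections v))

    chosen-zero : ∀ φ v → chosen 0 φ v ≡ φ v
    chosen-zero φ v = trans (ℚ.+-identityʳ _) (ℚ.*-identityˡ (φ v))

    chosen-suc : ∀ k φ x v → chosen (suc k) φ (x ∷ v) ≡ f x * chosen k φ v + chosen (suc k) (φ ∘ (x ∷_)) v
    chosen-suc k φ x v = begin
      chosen (suc k) φ (x ∷ v)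
        ≡⟨ ∑-choose-suc k x v (λ (b , r) → ∏ˡ b f * φ r) ⟩
      ∑ˡ[ (b , r) ∈ choose k v ] (f x * ∏ˡ b f * φ r) + chosen (suc k) (φ ∘ (x ∷_)) v
        ≡⟨ cong (_+ chosen (suc k) (φ ∘ (x ∷_)) v) (∑ˡ-cong (choose k v) λ (b , r) → ℚ.*-assoc (f x) (∏ˡ b f) (φ r)) ⟩
      ∑ˡ[ (b , r) ∈ choose k v ] (f x * (∏ˡ b f * φ r)) + chosen (suc k) (φ ∘ (x ∷_)) v
        ≡⟨ cong (_+ chosen (suc k) (φ ∘ (x ∷_)) v) (*-∑ˡ (f x) _ (choose k v)) ⟨
      f x * chosen k φ v + chosen (suc k) (φ ∘ (x ∷_)) v ∎

    -- A sublist of length k + 1 arises from each of its k + 1 entries.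
    selected-chosen : ∀ k φ v → selected (chosen k φ) v ≡ ⟦ suc k ⟧ * chosen (suc k) φ v
    selected-chosen k       φ []      = sym (ℚ.*-zeroʳ ⟦ suc k ⟧)
    selected-chosen zero    φ (x ∷ v) = begin
      selected (chosen 0 φ) (x ∷ v)
        ≡⟨ selected-∷ (chosen 0 φ) x v ⟩
      f x * chosen 0 φ v + selected (chosen 0 (φ ∘ (x ∷_))) v
        ≡⟨ cong (f x * chosen 0 φ v +_) (selected-chosen 0 (φ ∘ (x ∷_)) v) ⟩
      f x * chosen 0 φ v + 1ℚ * chosen 1 (φ ∘ (x ∷_)) v
        ≡⟨ solve 2 (λ a b → a :+ con 1ℚ :* b := con 1ℚ :* (a :+ b)) refl (f x * chosen 0 φ v) _ ⟩
      1ℚ * (f x * chosen 0 φ v + chosen 1 (φ ∘ (x ∷_)) v)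
        ≡⟨ cong (1ℚ *_) (chosen-suc 0 φ x v) ⟨
      1ℚ * chosen 1 φ (x ∷ v) ∎
    selected-chosen (suc k) φ (x ∷ v) = begin
      selected (chosen (suc k) φ) (x ∷ v)
        ≡⟨ selected-∷ (chosen (suc k) φ) x v ⟩
      f x * C + selected (λ r → chosen (suc k) φ (x ∷ r)) v
        ≡⟨ cong (f x * C +_) (begin
             selected (λ r → chosen (suc k) φ (x ∷ r)) v
               ≡⟨ ∑ˡ-cong (selections v) (λ (a , r) → trans (cong (f a *_) (chosen-suc k φ x r))
                    (solve 4 (λ a x b c → a :* (x :* b :+ c) := x :* (a :* b) :+ a :* c) refl (f a) (f x) _ _)) ⟩
             ∑ˡ[ (a , r) ∈ selections v ] (f x * (f a * chosen k φ r) + f a * chosen (suc k) φ′ r)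
               ≡⟨ ∑ˡ-+ _ _ (selections v) ⟩
             ∑ˡ[ (a , r) ∈ selections v ] (f x * (f a * chosen k φ r)) + selected (chosen (suc k) φ′) v
               ≡⟨ cong (_+ selected (chosen (suc k) φ′) v) (*-∑ˡ (f x) _ (selections v)) ⟨
             f x * selected (chosen k φ) v + selected (chosen (suc k) φ′) v
               ≡⟨ cong₂ (λ a b → f x * a + b) (selected-chosen k φ v) (selected-chosen (suc k) φ′ v) ⟩
             f x * (⟦ suc k ⟧ * C) + ⟦ suc (suc k) ⟧ * C′ ∎) ⟩
      f x * C + (f x * (⟦ suc k ⟧ * C) + ⟦ suc (suc k) ⟧ * C′)
        -- `f x * C` occurs once with `x` as the selected entry and `k + 1` times with `x` among the
        -- entries chosen afterwards; in `C′` the entry `x` is left over.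
        ≡⟨ solve 4 (λ x n c c′ → x :* c :+ (x :* (n :* c) :+ (n :+ con 1ℚ) :* c′)
             := (n :+ con 1ℚ) :* (x :* c :+ c′)) refl (f x) ⟦ suc k ⟧ C C′ ⟩
      ⟦ suc (suc k) ⟧ * (f x * C + C′)
        ≡⟨ cong (⟦ suc (suc k) ⟧ *_) (chosen-suc (suc k) φ x v) ⟨
      ⟦ suc (suc k) ⟧ * chosen (suc (suc k)) φ (x ∷ v) ∎
      where
      φ′ : List A → ℚ
      φ′ = φ ∘ (x ∷_)
      C C′ : ℚ
      C = chosen (suc k) φ v
      C′ = chosen (suc (suc k)) φ′ v

  ⟦⟧-+ : ∀ m n → ⟦ m ℕ.+ n ⟧ ≡ ⟦ m ⟧ + ⟦ n ⟧
  ⟦⟧-+ zero    n = sym (ℚ.+-identityˡ ⟦ n ⟧)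
  ⟦⟧-+ (suc m) n = trans (cong (_+ 1ℚ) (⟦⟧-+ m n))
    (solve 2 (λ a b → (a :+ b) :+ con 1ℚ := (a :+ con 1ℚ) :+ b) refl ⟦ m ⟧ ⟦ n ⟧)

  ⟦⟧-* : ∀ m n → ⟦ m ℕ.* n ⟧ ≡ ⟦ m ⟧ * ⟦ n ⟧
  ⟦⟧-* zero    n = sym (ℚ.*-zeroˡ ⟦ n ⟧)
  ⟦⟧-* (suc m) n = trans (⟦⟧-+ n (m ℕ.* n)) (trans (cong (⟦ n ⟧ +_) (⟦⟧-* m n))
    (solve 2 (λ a b → b :+ a :* b := (a :+ con 1ℚ) :* b) refl ⟦ m ⟧ ⟦ n ⟧))

  -- The first k entries of an arrangement form a sublist, taken in any of its k ! orders.
  ∑-arrangements-take : ∀ (f : A → ℚ) (ψ : List A → ℚ) k l v →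
    ∑ˡ[ w ∈ arrangements (k ℕ.+ l) v ] (∏ˡ (take k w) f * ψ (drop k w))
      ≡ ⟦ k ! ⟧ * chosen f k (λ r → ∑ˡ (arrangements l r) ψ) v
  ∑-arrangements-take f ψ zero l v = begin
    ∑ˡ[ w ∈ arrangements l v ] (1ℚ * ψ w)
      ≡⟨ *-∑ˡ 1ℚ ψ (arrangements l v) ⟨
    1ℚ * ∑ˡ (arrangements l v) ψ
      ≡⟨ cong (1ℚ *_) (chosen-zero f (λ r → ∑ˡ (arrangements l r) ψ) v) ⟨
    1ℚ * chosen f 0 (λ r → ∑ˡ (arrangements l r) ψ) v ∎
  ∑-arrangements-take f ψ (suc k) l v = begin
    ∑ˡ[ w ∈ arrangements (suc k ℕ.+ l) v ] (∏ˡ (take (suc k) w) f * ψ (drop (suc k) w))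
      ≡⟨ trans (∑ˡ-concatMap _ _ (selections v)) (∑ˡ-cong (selections v) λ (a , r) → ∑ˡ-map (a ∷_) _ (arrangements (k ℕ.+ l) r)) ⟩
    ∑ˡ[ (a , r) ∈ selections v ] ∑ˡ[ w ∈ arrangements (k ℕ.+ l) r ] (f a * ∏ˡ (take k w) f * ψ (drop k w))
      ≡⟨ ∑ˡ-cong (selections v) (λ (a , r) → begin
           ∑ˡ[ w ∈ arrangements (k ℕ.+ l) r ] (f a * ∏ˡ (take k w) f * ψ (drop k w))
             ≡⟨ ∑ˡ-cong (arrangements (k ℕ.+ l) r) (λ w → ℚ.*-assoc (f a) _ _) ⟩
           ∑ˡ[ w ∈ arrangements (k ℕ.+ l) r ] (f a * (∏ˡ (take k w) f * ψ (drop k w)))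
             ≡⟨ *-∑ˡ (f a) _ (arrangements (k ℕ.+ l) r) ⟨
           f a * ∑ˡ[ w ∈ arrangements (k ℕ.+ l) r ] (∏ˡ (take k w) f * ψ (drop k w))
             ≡⟨ cong (f a *_) (∑-arrangements-take f ψ k l r) ⟩
           f a * (⟦ k ! ⟧ * chosen f k Ψ r)
             ≡⟨ solve 3 (λ a b c → a :* (b :* c) := b :* (a :* c)) refl (f a) ⟦ k ! ⟧ (chosen f k Ψ r) ⟩
           ⟦ k ! ⟧ * (f a * chosen f k Ψ r) ∎) ⟩
    ∑ˡ[ (a , r) ∈ selections v ] (⟦ k ! ⟧ * (f a * chosen f k Ψ r))
      ≡⟨ *-∑ˡ ⟦ k ! ⟧ _ (selections v) ⟨
    ⟦ k ! ⟧ * selected f (chosen f k Ψ) v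
      ≡⟨ cong (⟦ k ! ⟧ *_) (selected-chosen f k Ψ v) ⟩
    ⟦ k ! ⟧ * (⟦ suc k ⟧ * chosen f (suc k) Ψ v)
      ≡⟨ solve 3 (λ a b c → a :* (b :* c) := (b :* a) :* c) refl ⟦ k ! ⟧ ⟦ suc k ⟧ (chosen f (suc k) Ψ v) ⟩
    ⟦ suc k ⟧ * ⟦ k ! ⟧ * chosen f (suc k) Ψ v
      ≡⟨ cong (_* chosen f (suc k) Ψ v) (⟦⟧-* (suc k) (k !)) ⟨
    ⟦ suc k ! ⟧ * chosen f (suc k) Ψ v ∎
    where
    Ψ : List _ → ℚ
    Ψ r = ∑ˡ (arrangements l r) ψ

  -- Permutations and compositions as lists

  -- `Fin.punchIn a` runs in order through the positions other than `a`, so the tabulated list is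
  -- what remains after the entry at `a` is selected.
  ∑-selections-tabulate : ∀ {n} (v : Fin (suc n) → A) (h : A → List A → ℚ) →
    ∑ˡ[ a ∈ allFin (suc n) ] h (v a) (tabulate (v ∘ Fin.punchIn a))
      ≡ ∑ˡ[ (x , r) ∈ selections (tabulate v) ] h x r
  ∑-selections-tabulate {n = zero}  v h = refl
  ∑-selections-tabulate {n = suc n} v h = cong (h (v zero) (tabulate (v ∘ suc)) +_) (begin
    ∑ˡ[ a ∈ tabulate suc ] h (v a) (tabulate (v ∘ Fin.punchIn a))
      ≡⟨ cong (λ xs → ∑ˡ xs (λ a → h (v a) (tabulate (v ∘ Fin.punchIn a)))) (List.map-tabulate id suc) ⟨
    ∑ˡ[ a ∈ map suc (allFin (suc n)) ] h (v a) (tabulate (v ∘ Fin.punchIn a))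
      ≡⟨ ∑ˡ-map Fin.suc (λ a → h (v a) (tabulate (v ∘ Fin.punchIn a))) (allFin (suc n)) ⟩
    ∑ˡ[ a ∈ allFin (suc n) ] h (v (suc a)) (v zero ∷ tabulate (v ∘ suc ∘ Fin.punchIn a))
      ≡⟨ ∑-selections-tabulate (v ∘ suc) (λ x r → h x (v zero ∷ r)) ⟩
    ∑ˡ[ (x , r) ∈ selections (tabulate (v ∘ suc)) ] h x (v zero ∷ r)
      ≡⟨ ∑ˡ-map (map₂ (v zero ∷_)) (λ (x , r) → h x r) (selections (tabulate (v ∘ suc))) ⟨
    ∑ˡ[ (x , r) ∈ map (map₂ (v zero ∷_)) (selections (tabulate (v ∘ suc))) ] h x r ∎)

  ∑ˡ-cartesianProductWith : ∀ {C : Set} (h : A → B → C) (f : C → ℚ) xs ys →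
    ∑ˡ (cartesianProductWith h xs ys) f ≡ ∑ˡ[ x ∈ xs ] ∑ˡ[ y ∈ ys ] f (h x y)
  ∑ˡ-cartesianProductWith h f []       ys = refl
  ∑ˡ-cartesianProductWith h f (x ∷ xs) ys = trans (∑ˡ-++ f (map (h x) ys) _)
    (cong₂ _+_ (∑ˡ-map (h x) f ys) (∑ˡ-cartesianProductWith h f xs ys))

  -- The two recursions agree: `insert zero a π` fixes the image `a` of `zero` and lets `π` permute
  -- the other points, just as an arrangement selects its head and then arranges the remainder.
  ∑-permutations : ∀ l (v : Fin l → A) (g : List A → ℚ) →
    ∑ˡ[ τ ∈ permutationsList l ] g (tabulate (λ x → v (τ ⟨$⟩ʳ x))) ≡ ∑ˡ (arrangements l (tabulate v)) g
  ∑-permutations zero    v g = refl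
  ∑-permutations (suc l) v g = begin
    ∑ˡ[ τ ∈ permutationsList (suc l) ] g (tabulate (λ x → v (τ ⟨$⟩ʳ x)))
      ≡⟨ ∑ˡ-cartesianProductWith (insert zero) _ (allFin (suc l)) (permutationsList l) ⟩
    ∑ˡ[ a ∈ allFin (suc l) ] ∑ˡ[ π ∈ permutationsList l ] g (tabulate (λ x → v (insert zero a π ⟨$⟩ʳ x)))
      ≡⟨ ∑ˡ-cong (allFin (suc l)) (λ a → ∑ˡ-cong (permutationsList l) λ π →
           cong (λ w → g (v a ∷ w)) (List.tabulate-cong λ x → cong v (Perm.insert-punchIn zero a π x))) ⟩
    ∑ˡ[ a ∈ allFin (suc l) ] ∑ˡ[ π ∈ permutationsList l ] g (v a ∷ tabulate (λ x → v (Fin.punchIn a (π ⟨$⟩ʳ x))))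
      ≡⟨ ∑ˡ-cong (allFin (suc l)) (λ a → ∑-permutations l (v ∘ Fin.punchIn a) (g ∘ (v a ∷_))) ⟩
    ∑ˡ[ a ∈ allFin (suc l) ] ∑ˡ (arrangements l (tabulate (v ∘ Fin.punchIn a))) (g ∘ (v a ∷_))
      ≡⟨ ∑-selections-tabulate v (λ x r → ∑ˡ (arrangements l r) (g ∘ (x ∷_))) ⟩
    ∑ˡ[ (x , r) ∈ selections (tabulate v) ] ∑ˡ (arrangements l r) (g ∘ (x ∷_))
      ≡⟨ ∑ˡ-cong (selections (tabulate v)) (λ (x , r) → ∑ˡ-map (x ∷_) g (arrangements l r)) ⟨
    ∑ˡ[ (x , r) ∈ selections (tabulate v) ] ∑ˡ (map (x ∷_) (arrangements l r)) g
      ≡⟨ ∑ˡ-concatMap (λ (x , r) → map (x ∷_) (arrangements l r)) g (selections (tabulate v)) ⟨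
    ∑ˡ (arrangements (suc l) (tabulate v)) g ∎

  -- A composition either starts with 1 or has a first part that can be decreased. Iterating this
  -- sorts compositions by their first part; the hypothesis for `g ∘ incrementFirst` shifts that
  -- part by one.
  ∑-compositions : ∀ l (g : List ℕ → ℚ) →
    ∑ˡ[ η ∈ compositionsList (suc l) ] g (parts η)
      ≡ ∑ˡ[ k ∈ upTo (suc l) ] ∑ˡ[ η ∈ compositionsList (l ∸ k) ] g (suc k ∷ parts η)
  ∑-compositions zero    g = sym (ℚ.+-identityʳ _)
  ∑-compositions (suc l) g = begin
    ∑ˡ[ η ∈ compositionsList (suc (suc l)) ] g (parts η)
      ≡⟨ split-first _ _ (λ _ → refl) (λ { record { parts = _ ∷ _ ; positive = _ ∷ _ } → refl
                          ; record { parts = [] ; total = () } }) ⟩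
    ∑ˡ[ η ∈ compositionsList (suc l) ] g (1 ∷ parts η) + ∑ˡ[ η ∈ compositionsList (suc l) ] g (incrementFirst (parts η))
      ≡⟨ cong (∑ˡ (compositionsList (suc l)) (λ η → g (1 ∷ parts η)) +_) (∑-compositions l (g ∘ incrementFirst)) ⟩
    ∑ˡ[ η ∈ compositionsList (suc l) ] g (1 ∷ parts η) +
      ∑ˡ[ k ∈ upTo (suc l) ] ∑ˡ[ η ∈ compositionsList (l ∸ k) ] g (suc (suc k) ∷ parts η)
      ≡⟨ ∑ˡ-upTo-suc (λ k → ∑ˡ[ η ∈ compositionsList (suc l ∸ k) ] g (suc k ∷ parts η)) (suc l) ⟨
    ∑ˡ[ k ∈ upTo (suc (suc l)) ] ∑ˡ[ η ∈ compositionsList (suc l ∸ k) ] g (suc k ∷ parts η) ∎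
    where
    incrementFirst : List ℕ → List ℕ
    -- A default value, never reached: a composition of `suc l` has at least one part.
    incrementFirst []       = []
    incrementFirst (k ∷ ks) = suc k ∷ ks
    -- The two maps that build `compositionsList` are private. Abstracting over them lets
    -- unification supply them; only their effect on `parts` matters.
    split-first : (one grow : Composition (suc l) → Composition (suc (suc l))) →
      (∀ η → parts (one η) ≡ 1 ∷ parts η) → (∀ η → parts (grow η) ≡ incrementFirst (parts η)) →
      ∑ˡ (map one (compositionsList (suc l)) ++ map grow (compositionsList (suc l))) (g ∘ parts)
        ≡ ∑ˡ[ η ∈ compositionsList (suc l) ] g (1 ∷ parts η) + ∑ˡ[ η ∈ compositionsList (suc l) ] g (incrementFirst (parts η))
    split-first one grow eq₁ eq₂ = trans
      (∑ˡ-map-++ one grow (g ∘ parts) (compositionsList (suc l)) (compositionsList (suc l)))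
      (cong₂ _+_ (∑ˡ-cong (compositionsList (suc l)) (cong g ∘ eq₁)) (∑ˡ-cong (compositionsList (suc l)) (cong g ∘ eq₂)))

  -- Interchanging sums, and congruence for chosen sublists

  ∑ˡ-swap : ∀ (h : A → B → ℚ) xs ys → ∑ˡ[ x ∈ xs ] ∑ˡ ys (h x) ≡ ∑ˡ[ y ∈ ys ] ∑ˡ[ x ∈ xs ] h x y
  ∑ˡ-swap h []       ys = sym (∑ˡ-zero ys)
  ∑ˡ-swap h (x ∷ xs) ys = trans (cong (∑ˡ ys (h x) +_) (∑ˡ-swap h xs ys)) (sym (∑ˡ-+ (h x) (λ y → ∑ˡ xs (λ x → h x y)) ys))

  -- Restricts the comparison to remainders of the right length, so that an identity whose index is
  -- `length r` can be applied under `chosen`.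
  chosen-cong-length : ∀ (f : A → ℚ) k {φ ψ : List A → ℚ} v →
    (∀ r → k ℕ.+ length r ≡ length v → φ r ≡ ψ r) → chosen f k φ v ≡ chosen f k ψ v
  chosen-cong-length f k v φ≡ψ =
    ∑ˡ-cong-All (All.map (λ {(b , r)} (_ , eq) → cong (∏ˡ b f *_) (φ≡ψ r eq)) (choose-length k v))

  *-chosen : ∀ c (f : A → ℚ) k φ v → c * chosen f k φ v ≡ chosen f k (λ r → c * φ r) v
  *-chosen c f k φ v = trans (*-∑ˡ c _ (choose k v)) (∑ˡ-cong (choose k v) λ (b , r) →
    solve 3 (λ a b c → a :* (b :* c) := b :* (a :* c)) refl c (∏ˡ b f) (φ r))

  ∑ˡ-chosen : ∀ (f : A → ℚ) k (φ : B → List A → ℚ) xs v →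
    ∑ˡ[ x ∈ xs ] chosen f k (φ x) v ≡ chosen f k (λ r → ∑ˡ[ x ∈ xs ] φ x r) v
  ∑ˡ-chosen f k φ xs v = trans (∑ˡ-swap _ xs (choose k v))
    (∑ˡ-cong (choose k v) λ (b , r) → sym (*-∑ˡ (∏ˡ b f) (λ x → φ x r) xs))

  -- Cancellation in quotients

  ⟦⟧≢0 : ∀ n .{{_ : ℕ.NonZero n}} → ⟦ n ⟧ ≢ 0ℚ
  ⟦⟧≢0 (suc n) eq with () ← trans (sym (r-inverse n)) (trans (cong (1/suc n *_) eq) (ℚ.*-zeroʳ (1/suc n)))

  *≢0 : ∀ {p q} → p ≢ 0ℚ → q ≢ 0ℚ → p * q ≢ 0ℚ
  *≢0 {p} {q} p≢0 q≢0 pq≡0 = q≢0 (begin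
    q                    ≡⟨ ℚ.*-identityˡ q ⟨
    1ℚ * q               ≡⟨ cong (_* q) (invℚ-inverse p≢0) ⟨
    invℚ p * p * q       ≡⟨ ℚ.*-assoc (invℚ p) p q ⟩
    invℚ p * (p * q)     ≡⟨ cong (invℚ p *_) pq≡0 ⟩
    invℚ p * 0ℚ          ≡⟨ ℚ.*-zeroʳ (invℚ p) ⟩
    0ℚ                   ∎)

  -- Used to cancel the zeta factor of a chosen index and the factorial of a first block.
  *-invℚ-* : ∀ {p q} → p ≢ 0ℚ → q ≢ 0ℚ → p * invℚ (p * q) ≡ invℚ q
  *-invℚ-* {p} {q} p≢0 q≢0 = begin
    p * invℚ (p * q)
      ≡⟨ ℚ.*-identityʳ _ ⟨
    p * invℚ (p * q) * 1ℚ
      ≡⟨ cong (p * invℚ (p * q) *_) (invℚ-inverse q≢0) ⟨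
    p * invℚ (p * q) * (invℚ q * q)
      ≡⟨ solve 4 (λ p i j q → (p :* i) :* (j :* q) := (i :* (p :* q)) :* j) refl p (invℚ (p * q)) (invℚ q) q ⟩
    invℚ (p * q) * (p * q) * invℚ q
      ≡⟨ cong (_* invℚ q) (invℚ-inverse (*≢0 p≢0 q≢0)) ⟩
    1ℚ * invℚ q
      ≡⟨ ℚ.*-identityˡ (invℚ q) ⟩
    invℚ q ∎

  ∏ℚ≢0 : ∀ {n} (f : Fin n → ℚ) → (∀ k → f k ≢ 0ℚ) → ∏ℚ f ≢ 0ℚ
  ∏ℚ≢0 {zero}  f f≢0 ()
  ∏ℚ≢0 {suc n} f f≢0 = *≢0 (f≢0 zero) (∏ℚ≢0 (f ∘ suc) (f≢0 ∘ suc))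

  -- Increasing index choices as sublists

  -- The quotient leaves exactly the factors at the unchosen positions, that is, over the remainder
  -- `r`. Both sides split on whether the first position is chosen: if so its factor cancels,
  -- otherwise it comes out in front.
  ∑-increasing : ∀ l m (i : Fin m → A) (z : A → ℚ) → (∀ k → z (i k) ≢ 0ℚ) → (g : List A → ℚ) →
    ∑ˡ[ j ∈ increasingList l m ] (∏ℚ (z ∘ i) * invℚ (∏ℚ (z ∘ i ∘ at j)) * g (tabulate (i ∘ at j)))
      ≡ ∑ˡ[ (b , r) ∈ choose l (tabulate i) ] (∏ˡ r z * g b)
  ∑-increasing zero    m       i z z≢0 g =
    cong (λ t → t * g [] + 0ℚ) (trans (ℚ.*-identityʳ (∏ℚ (z ∘ i))) (sym (∏ˡ-tabulate i z)))
  ∑-increasing (suc l) zero    i z z≢0 g = refl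
  ∑-increasing {A = A} (suc l) (suc m) i z z≢0 g = begin
    ∑ˡ (increasingList (suc l) (suc m)) term
      -- The omitted arguments are the private maps `keep` and `skip`, which choose or pass over the
      -- first position.
      ≡⟨ ∑ˡ-map-++ _ _ term (increasingList l m) (increasingList (suc l) m) ⟩
    _
      ≡⟨ cong₂ _+_
           (∑ˡ-cong (increasingList l m) λ j → cong (_* g (i zero ∷ tabulate (i ∘ suc ∘ at j)))
             (trans (solve 3 (λ a p c → (a :* p) :* c := p :* (a :* c)) refl (z (i zero)) P
                      (invℚ (z (i zero) * ∏ℚ (z ∘ i ∘ suc ∘ at j))))
               (cong (P *_) (*-invℚ-* (z≢0 zero) (∏ℚ≢0 (z ∘ i ∘ suc ∘ at j) (z≢0 ∘ suc ∘ at j))))))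
           (∑ˡ-cong (increasingList (suc l) m) λ j →
             solve 4 (λ a p c d → (a :* p) :* c :* d := a :* (p :* c :* d)) refl (z (i zero)) P
               (invℚ (∏ℚ (z ∘ i ∘ suc ∘ at j))) (g (tabulate (i ∘ suc ∘ at j)))) ⟩
    ∑ˡ[ j ∈ increasingList l m ] (P * invℚ (∏ℚ (z ∘ i ∘ suc ∘ at j)) * g (i zero ∷ tabulate (i ∘ suc ∘ at j))) +
      ∑ˡ[ j ∈ increasingList (suc l) m ] (z (i zero) * (P * invℚ (∏ℚ (z ∘ i ∘ suc ∘ at j)) * g (tabulate (i ∘ suc ∘ at j))))
      ≡⟨ cong₂ _+_
           (∑-increasing l m (i ∘ suc) z (z≢0 ∘ suc) (g ∘ (i zero ∷_)))
           (trans (sym (*-∑ˡ (z (i zero)) _ (increasingList (suc l) m)))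
             (cong (z (i zero) *_) (∑-increasing (suc l) m (i ∘ suc) z (z≢0 ∘ suc) g))) ⟩
    ∑ˡ[ (b , r) ∈ choose l v ] (∏ˡ r z * g (i zero ∷ b)) +
      z (i zero) * ∑ˡ[ (b , r) ∈ choose (suc l) v ] (∏ˡ r z * g b)
      ≡⟨ cong (∑ˡ[ (b , r) ∈ choose l v ] (∏ˡ r z * g (i zero ∷ b)) +_)
           (trans (*-∑ˡ (z (i zero)) _ (choose (suc l) v))
             (∑ˡ-cong (choose (suc l) v) λ (b , r) → sym (ℚ.*-assoc (z (i zero)) (∏ˡ r z) (g b)))) ⟩
    ∑ˡ[ (b , r) ∈ choose l v ] (∏ˡ r z * g (i zero ∷ b)) +
      ∑ˡ[ (b , r) ∈ choose (suc l) v ] (z (i zero) * ∏ˡ r z * g b)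
      ≡⟨ ∑-choose-suc l (i zero) v (λ (b , r) → ∏ˡ r z * g b) ⟨
    ∑ˡ[ (b , r) ∈ choose (suc l) (tabulate i) ] (∏ˡ r z * g b) ∎
    where
    v : List A
    v = tabulate (i ∘ suc)
    P : ℚ
    P = ∏ℚ (z ∘ i ∘ suc)
    term : Increasing (suc l) (suc m) → ℚ
    term j = ∏ℚ (z ∘ i) * invℚ (∏ℚ (z ∘ i ∘ at j)) * g (tabulate (i ∘ at j))

  -- Weights of a block

  -- The entries of a block share one summation variable, so the power with their total exponent
  -- splits into one factor per entry.
  power-sum : ∀ n ss → 1/[1+ n ]^ sum ss ≡ ∏ˡ ss (1/[1+ n ]^_)
  power-sum n []       = refl
  power-sum n (s ∷ ss) = trans (powers n s (sum ss)) (cong (1/[1+ n ]^ s *_) (power-sum n ss))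

  1/factorials : List ℕ → ℚ
  1/factorials ks = invℚ ⟦ factorials ks ⟧

  -- Removes the orders of the first block that `∑-arrangements-take` counts.
  !*1/factorials : ∀ k ks → ⟦ k ! ⟧ * 1/factorials (k ∷ ks) ≡ 1/factorials ks
  !*1/factorials k ks = trans (cong (λ t → ⟦ k ! ⟧ * invℚ t) (⟦⟧-* (k !) (factorials ks)))
    (*-invℚ-* (⟦⟧≢0 (k !) {{k ℕ.!≢0}}) (⟦⟧≢0 (factorials ks) {{factorials≢0 ks}}))

  ∏-negate : ∀ (t : A → ℚ) b → ∏ˡ b (λ s → - 1ℚ * t s) ≡ (- 1ℚ) ^ length b * ∏ˡ b t
  ∏-negate t []      = refl
  ∏-negate t (s ∷ b) = trans (cong (- 1ℚ * t s *_) (∏-negate t b))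
    (solve 4 (λ e a c d → (e :* a) :* (c :* d) := (e :* c) :* (a :* d)) refl (- 1ℚ) (t s) ((- 1ℚ) ^ length b) (∏ˡ b t))

  -- The identity for partial sums

  module _ (q : ℕ) where

    -- The sum over compositions and permutations in the theorem with each zeta value truncated at
    -- `N`; permutations of the chosen indices become arrangements of the list of their exponents.
    orderedSum : ℕ → ℕ → List ℕ → ℚ
    orderedSum N l v =
      ∑ˡ[ η ∈ compositionsList l ] ∑ˡ[ w ∈ arrangements l v ]
        (mzv (map sum (blocks (parts η) w) ++ q ∷ []) N * 1/factorials (parts η))

    -- The variables of the tails exceed `n + 1` and are at most `N`, but are not compared with each
    -- other; `orderedSum` is the same sum with their order resolved into blocks.
    tailProductSum : ℕ → List ℕ → ℚ
    tailProductSum N v = ∑< N (λ n → 1/[1+ n ]^ q * ∏ˡ v (λ s → H s N - H s (suc n)))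

    -- Here `n + 1` is the largest variable and `k + 1` the size of the first block, whose entries
    -- all have that variable. The `(k + 1) !` orders of the block cancel its factorial, and what is
    -- left is an `orderedSum` over variables at most `n`.
    orderedSum-suc : ∀ N l v →
      orderedSum N (suc l) v
        ≡ ∑< N (λ n → ∑ˡ[ k ∈ upTo (suc l) ] chosen (1/[1+ n ]^_) (suc k) (orderedSum n (l ∸ k)) v)
    orderedSum-suc N l v = begin
      orderedSum N (suc l) v
        ≡⟨ ∑-compositions l (λ ks → ∑ˡ[ w ∈ arrangements (suc l) v ]
             (mzv (map sum (blocks ks w) ++ q ∷ []) N * 1/factorials ks)) ⟩
      ∑ˡ[ k ∈ upTo (suc l) ] ∑ˡ[ η ∈ compositionsList (l ∸ k) ] ∑ˡ[ w ∈ arrangements (suc l) v ]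
        (mzv (sum (take (suc k) w) ∷ rest (parts η) (drop (suc k) w)) N * 1/factorials (suc k ∷ parts η))
        ≡⟨ ∑ˡ-cong (upTo (suc l)) (λ k → ∑ˡ-cong (compositionsList (l ∸ k)) λ η →
             ∑ˡ-cong (arrangements (suc l) v) λ w → first-term k (parts η) w) ⟩
      ∑ˡ[ k ∈ upTo (suc l) ] ∑ˡ[ η ∈ compositionsList (l ∸ k) ] ∑ˡ[ w ∈ arrangements (suc l) v ]
        ∑< N (body k (parts η) w)
        ≡⟨ trans (∑ˡ-cong (upTo (suc l)) λ k → trans (∑ˡ-cong (compositionsList (l ∸ k)) λ η →
               ∑ˡ-∑< (body k (parts η)) (arrangements (suc l) v) N)
             (∑ˡ-∑< (λ η n → ∑ˡ[ w ∈ arrangements (suc l) v ] body k (parts η) w n) (compositionsList (l ∸ k)) N))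
           (∑ˡ-∑< (λ k n → ∑ˡ[ η ∈ compositionsList (l ∸ k) ] ∑ˡ[ w ∈ arrangements (suc l) v ] body k (parts η) w n)
             (upTo (suc l)) N) ⟩
      ∑< N (λ n → ∑ˡ[ k ∈ upTo (suc l) ] ∑ˡ[ η ∈ compositionsList (l ∸ k) ] ∑ˡ[ w ∈ arrangements (suc l) v ]
        body k (parts η) w n)
        -- The bound on `k` is kept because `l ∸ k` is truncated: only for `k ≤ l` do the block and
        -- the rest make up the whole length.
        ≡⟨ ∑<-cong (λ n → ∑ˡ-cong-All (All.map (λ {k} → first-block n k) (upTo-< (suc l)))) N ⟩
      ∑< N (λ n → ∑ˡ[ k ∈ upTo (suc l) ] chosen (1/[1+ n ]^_) (suc k) (orderedSum n (l ∸ k)) v) ∎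
      where
      rest : List ℕ → List ℕ → List ℕ
      rest ks w = map sum (blocks ks w) ++ q ∷ []
      ψ : ℕ → ℕ → List ℕ → List ℕ → ℚ
      ψ n k ks w = mzv (rest ks w) n * 1/factorials (suc k ∷ ks)
      body : ℕ → List ℕ → List ℕ → ℕ → ℚ
      body k ks w n = ∏ˡ (take (suc k) w) (1/[1+ n ]^_) * ψ n k ks (drop (suc k) w)
      first-term : ∀ k ks w →
        mzv (sum (take (suc k) w) ∷ rest ks (drop (suc k) w)) N * 1/factorials (suc k ∷ ks) ≡ ∑< N (body k ks w)
      first-term k ks w = begin
        mzv (sum b ∷ ss) N * c
          ≡⟨ ℚ.*-comm _ c ⟩
        c * mzv (sum b ∷ ss) N
          ≡⟨ *-∑< c _ N ⟩
        ∑< N (λ n → c * (1/[1+ n ]^ sum b * mzv ss n))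
          ≡⟨ ∑<-cong (λ n → trans
               (solve 3 (λ a b c → c :* (a :* b) := a :* (b :* c)) refl (1/[1+ n ]^ sum b) (mzv ss n) c)
               (cong (_* (mzv ss n * c)) (power-sum n b))) N ⟩
        ∑< N (body k ks w) ∎
        where
        b ss : List ℕ
        b = take (suc k) w
        ss = rest ks (drop (suc k) w)
        c : ℚ
        c = 1/factorials (suc k ∷ ks)
      first-block : ∀ n k → k ℕ.< suc l →
        ∑ˡ[ η ∈ compositionsList (l ∸ k) ] ∑ˡ[ w ∈ arrangements (suc l) v ] body k (parts η) w n
          ≡ chosen (1/[1+ n ]^_) (suc k) (orderedSum n (l ∸ k)) v
      first-block n k (s≤s k≤l) = trans
        (∑ˡ-cong (compositionsList (l ∸ k)) λ η → begin
          ∑ˡ[ w ∈ arrangements (suc l) v ] body k (parts η) w n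
            ≡⟨ cong (λ t → ∑ˡ[ w ∈ arrangements (suc t) v ] body k (parts η) w n) (ℕ.m+[n∸m]≡n k≤l) ⟨
          ∑ˡ[ w ∈ arrangements (suc k ℕ.+ (l ∸ k)) v ] body k (parts η) w n
            ≡⟨ ∑-arrangements-take y (ψ n k (parts η)) (suc k) (l ∸ k) v ⟩
          ⟦ suc k ! ⟧ * chosen y (suc k) (λ r → ∑ˡ (arrangements (l ∸ k) r) (ψ n k (parts η))) v
            ≡⟨ *-chosen ⟦ suc k ! ⟧ y (suc k) _ v ⟩
          chosen y (suc k) (λ r → ⟦ suc k ! ⟧ * ∑ˡ (arrangements (l ∸ k) r) (ψ n k (parts η))) v
            ≡⟨ chosen-cong-length y (suc k) v (λ r _ → trans (*-∑ˡ ⟦ suc k ! ⟧ _ (arrangements (l ∸ k) r))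
                 (∑ˡ-cong (arrangements (l ∸ k) r) λ w → cancel (parts η) w)) ⟩
          chosen y (suc k) (λ r → ∑ˡ[ w ∈ arrangements (l ∸ k) r ] (mzv (rest (parts η) w) n * 1/factorials (parts η))) v ∎)
        (∑ˡ-chosen y (suc k)
          (λ η r → ∑ˡ[ w ∈ arrangements (l ∸ k) r ] (mzv (rest (parts η) w) n * 1/factorials (parts η)))
          (compositionsList (l ∸ k)) v)
        where
        y : ℕ → ℚ
        y = 1/[1+ n ]^_
        cancel : ∀ ks w → ⟦ suc k ! ⟧ * ψ n k ks w ≡ mzv (rest ks w) n * 1/factorials ks
        cancel ks w = trans
          (solve 3 (λ a b c → a :* (b :* c) := b :* (a :* c)) refl ⟦ suc k ! ⟧ (mzv (rest ks w) n) (1/factorials (suc k ∷ ks)))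
          (cong (mzv (rest ks w) n *_) (!*1/factorials (suc k) ks))

    -- Raising the bound adds one term, with variable `N + 1`, to every tail. Expanding the product,
    -- `b` holds the factors whose variable equals `N + 1`.
    tailProductSum-suc : ∀ N x v →
      tailProductSum (suc N) (x ∷ v)
        ≡ ∑ˡ[ (b , r) ∈ splits (x ∷ v) ] (∏ˡ b (1/[1+ N ]^_) * tailProductSum N r)
    tailProductSum-suc N x v = begin
      ∑< N (λ n → 1/[1+ n ]^ q * ∏ˡ (x ∷ v) (λ s → H s N + y s - H s (suc n))) +
        1/[1+ N ]^ q * ((H x (suc N) - H x (suc N)) * Q)
        -- In the new summand `n = N` the tail belonging to `x` is empty, so the summand vanishes.
        -- This is where the list must be nonempty.
        ≡⟨ cong (∑< N (λ n → 1/[1+ n ]^ q * ∏ˡ (x ∷ v) (λ s → H s N + y s - H s (suc n))) +_)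
             (solve 3 (λ a h c → a :* ((h :- h) :* c) := con 0ℚ) refl (1/[1+ N ]^ q) (H x (suc N)) Q) ⟩
      ∑< N (λ n → 1/[1+ n ]^ q * ∏ˡ (x ∷ v) (λ s → H s N + y s - H s (suc n))) + 0ℚ
        ≡⟨ ℚ.+-identityʳ _ ⟩
      ∑< N (λ n → 1/[1+ n ]^ q * ∏ˡ (x ∷ v) (λ s → H s N + y s - H s (suc n)))
        ≡⟨ ∑<-cong expand N ⟩
      ∑< N (λ n → ∑ˡ[ (b , r) ∈ splits (x ∷ v) ] (∏ˡ b y * (1/[1+ n ]^ q * ∏ˡ r (T n))))
        ≡⟨ ∑ˡ-∑< (λ (b , r) n → ∏ˡ b y * (1/[1+ n ]^ q * ∏ˡ r (T n))) (splits (x ∷ v)) N ⟨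
      ∑ˡ[ (b , r) ∈ splits (x ∷ v) ] ∑< N (λ n → ∏ˡ b y * (1/[1+ n ]^ q * ∏ˡ r (T n)))
        ≡⟨ ∑ˡ-cong (splits (x ∷ v)) (λ (b , r) → *-∑< (∏ˡ b y) _ N) ⟨
      ∑ˡ[ (b , r) ∈ splits (x ∷ v) ] (∏ˡ b y * tailProductSum N r) ∎
      where
      y : ℕ → ℚ
      y = 1/[1+ N ]^_
      T : ℕ → ℕ → ℚ
      T n s = H s N - H s (suc n)
      Q : ℚ
      Q = ∏ˡ v (λ s → H s (suc N) - H s (suc N))
      expand : ∀ n → 1/[1+ n ]^ q * ∏ˡ (x ∷ v) (λ s → H s N + y s - H s (suc n))
                       ≡ ∑ˡ[ (b , r) ∈ splits (x ∷ v) ] (∏ˡ b y * (1/[1+ n ]^ q * ∏ˡ r (T n)))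
      expand n = begin
        1/[1+ n ]^ q * ∏ˡ (x ∷ v) (λ s → H s N + y s - H s (suc n))
          ≡⟨ cong (1/[1+ n ]^ q *_) (∏ˡ-cong (x ∷ v) λ s →
               solve 3 (λ a b c → (a :+ b) :- c := b :+ (a :- c)) refl (H s N) (y s) (H s (suc n))) ⟩
        1/[1+ n ]^ q * ∏ˡ (x ∷ v) (λ s → y s + T n s)
          ≡⟨ cong (1/[1+ n ]^ q *_) (∏-+ y (T n) (x ∷ v)) ⟩
        1/[1+ n ]^ q * ∑ˡ[ (b , r) ∈ splits (x ∷ v) ] (∏ˡ b y * ∏ˡ r (T n))
          ≡⟨ *-∑ˡ (1/[1+ n ]^ q) _ (splits (x ∷ v)) ⟩
        ∑ˡ[ (b , r) ∈ splits (x ∷ v) ] (1/[1+ n ]^ q * (∏ˡ b y * ∏ˡ r (T n)))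
          ≡⟨ ∑ˡ-cong (splits (x ∷ v)) (λ (b , r) →
               solve 3 (λ a b c → a :* (b :* c) := b :* (a :* c)) refl (1/[1+ n ]^ q) (∏ˡ b y) (∏ˡ r (T n))) ⟩
        ∑ˡ[ (b , r) ∈ splits (x ∷ v) ] (∏ˡ b y * (1/[1+ n ]^ q * ∏ˡ r (T n))) ∎

    -- Induction on `N` for all lists at once, because the step passes to the remainders `r`.
    -- Sorting the splits by the number of variables equal to `N + 1` reproduces `orderedSum-suc`.
    tailProductSum≡orderedSum : ∀ N v → tailProductSum N v ≡ orderedSum N (length v) v
    tailProductSum≡orderedSum N [] = trans (sym (ℚ.*-identityʳ _))
      (sym (trans (ℚ.+-identityʳ _) (ℚ.+-identityʳ _)))
    tailProductSum≡orderedSum zero (x ∷ v) = sym (orderedSum-suc zero (length v) (x ∷ v))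
    tailProductSum≡orderedSum (suc N) (x ∷ v) = begin
      tailProductSum (suc N) (x ∷ v)
        ≡⟨ tailProductSum-suc N x v ⟩
      ∑ˡ[ (b , r) ∈ splits (x ∷ v) ] (∏ˡ b y * tailProductSum N r)
        ≡⟨ ∑-splits-by-size (x ∷ v) ℕ.≤-refl _ ⟩
      ∑ˡ[ k ∈ upTo (suc (suc l)) ] chosen y k (tailProductSum N) (x ∷ v)
        ≡⟨ ∑ˡ-upTo-suc (λ k → chosen y k (tailProductSum N) (x ∷ v)) (suc l) ⟩
      chosen y 0 (tailProductSum N) (x ∷ v) + ∑ˡ[ k ∈ upTo (suc l) ] chosen y (suc k) (tailProductSum N) (x ∷ v)
        ≡⟨ cong₂ _+_
             -- No variable equals `N + 1`: this gives the summands below `N`.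
             (trans (chosen-zero y (tailProductSum N) (x ∷ v))
               (trans (tailProductSum≡orderedSum N (x ∷ v)) (orderedSum-suc N l (x ∷ v))))
             -- At least one variable equals `N + 1`: this gives the summand at `N`, once `length r`
             -- is rewritten as `l ∸ k`.
             (∑ˡ-cong (upTo (suc l)) λ k → chosen-cong-length y (suc k) (x ∷ v) λ r eq →
               trans (tailProductSum≡orderedSum N r) (cong (λ t → orderedSum N t r)
                 (trans (sym (ℕ.m+n∸m≡n (suc k) (length r))) (cong (_∸ suc k) eq)))) ⟩
      ∑< N step + step N
        ≡⟨ orderedSum-suc (suc N) l (x ∷ v) ⟨
      orderedSum (suc N) (suc l) (x ∷ v) ∎
      where
      l : ℕ
      l = length v
      y : ℕ → ℚ
      y = 1/[1+ N ]^_
      step : ℕ → ℚ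
      step n = ∑ˡ[ k ∈ upTo (suc l) ] chosen (1/[1+ n ]^_) (suc k) (orderedSum n (l ∸ k)) (x ∷ v)

    -- In the expanded product, `b` holds the factors that contribute a negated tail and `r` those
    -- that contribute a truncated zeta value. Summing over `n` gives `tailProductSum N b`, and
    -- sorting by the length `l` of `b` gives the sign.
    ∑<-eulerTerm : ∀ {m} (i : Fin m → ℕ) N → (∀ k → mzv (i k ∷ []) N ≢ 0ℚ) →
      ∑< N (eulerTerm i q)
        ≡ ∑ˡ[ l ∈ upTo (suc m) ] ((- 1ℚ) ^ l * ∑ˡ[ j ∈ increasingList l m ]
            (∏ℚ (λ k → mzv (i k ∷ []) N) * invℚ (∏ℚ (λ k → mzv (i (at j k) ∷ []) N))
              * orderedSum N l (tabulate (i ∘ at j))))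
    ∑<-eulerTerm {m} i N z≢0 = begin
      ∑< N (eulerTerm i q)
        ≡⟨ ∑<-cong expand N ⟩
      ∑< N (λ n → ∑ˡ (splits v) (λ s → term s n))
        ≡⟨ ∑ˡ-∑< term (splits v) N ⟨
      ∑ˡ[ s ∈ splits v ] ∑< N (term s)
        ≡⟨ ∑ˡ-cong (splits v) (λ (b , r) → trans
             (sym (*-∑< ((- 1ℚ) ^ length b * ∏ˡ r z) _ N))
             (ℚ.*-assoc ((- 1ℚ) ^ length b) (∏ˡ r z) (tailProductSum N b))) ⟩
      ∑ˡ[ (b , r) ∈ splits v ] ((- 1ℚ) ^ length b * (∏ˡ r z * tailProductSum N b))
        ≡⟨ ∑-splits-by-size v (ℕ.≤-reflexive (List.length-tabulate i)) _ ⟩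
      ∑ˡ[ l ∈ upTo (suc m) ] ∑ˡ[ (b , r) ∈ choose l v ] ((- 1ℚ) ^ length b * (∏ˡ r z * tailProductSum N b))
        ≡⟨ ∑ˡ-cong (upTo (suc m)) (λ l → begin
             ∑ˡ[ (b , r) ∈ choose l v ] ((- 1ℚ) ^ length b * (∏ˡ r z * tailProductSum N b))
               ≡⟨ ∑ˡ-cong-All (All.map (λ { {b , r} (refl , _) →
                    cong (λ t → (- 1ℚ) ^ length b * (∏ˡ r z * t)) (tailProductSum≡orderedSum N b) }) (choose-length l v)) ⟩
             ∑ˡ[ (b , r) ∈ choose l v ] ((- 1ℚ) ^ l * (∏ˡ r z * orderedSum N l b))
               ≡⟨ *-∑ˡ ((- 1ℚ) ^ l) _ (choose l v) ⟨
             (- 1ℚ) ^ l * ∑ˡ[ (b , r) ∈ choose l v ] (∏ˡ r z * orderedSum N l b)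
               ≡⟨ cong ((- 1ℚ) ^ l *_) (∑-increasing l m i z z≢0 (orderedSum N l)) ⟨
             (- 1ℚ) ^ l * ∑ˡ[ j ∈ increasingList l m ]
               (∏ℚ (z ∘ i) * invℚ (∏ℚ (z ∘ i ∘ at j)) * orderedSum N l (tabulate (i ∘ at j))) ∎) ⟩
      ∑ˡ[ l ∈ upTo (suc m) ] ((- 1ℚ) ^ l * ∑ˡ[ j ∈ increasingList l m ]
        (∏ℚ (z ∘ i) * invℚ (∏ℚ (z ∘ i ∘ at j)) * orderedSum N l (tabulate (i ∘ at j)))) ∎
      where
      v : List ℕ
      v = tabulate i
      z : ℕ → ℚ
      z s = mzv (s ∷ []) N
      T : ℕ → ℕ → ℚ
      T n s = H s N - H s (suc n)
      term : List ℕ × List ℕ → ℕ → ℚ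
      term (b , r) n = (- 1ℚ) ^ length b * ∏ˡ r z * (1/[1+ n ]^ q * ∏ˡ b (T n))
      H≡ : ∀ n s → H s (suc n) ≡ - 1ℚ * T n s + z s
      H≡ n s = trans
        (solve 2 (λ h k → h := con (- 1ℚ) :* (k :- h) :+ k) refl (H s (suc n)) (H s N))
        -- `z s` is `H s N` up to a factor 1 in each summand, the value of the empty inner sum of
        -- `mzv`.
        (cong (- 1ℚ * T n s +_) (∑<-cong (λ k → sym (ℚ.*-identityʳ (1/[1+ k ]^ s))) N))
      expand : ∀ n → eulerTerm i q n ≡ ∑ˡ (splits v) (λ s → term s n)
      expand n = begin
        ∏ℚ (λ k → H (i k) (suc n)) * 1/[1+ n ]^ q
          ≡⟨ cong (_* 1/[1+ n ]^ q) (∏ˡ-tabulate i (λ s → H s (suc n))) ⟨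
        ∏ˡ v (λ s → H s (suc n)) * 1/[1+ n ]^ q
          ≡⟨ ℚ.*-comm _ (1/[1+ n ]^ q) ⟩
        1/[1+ n ]^ q * ∏ˡ v (λ s → H s (suc n))
          ≡⟨ cong (1/[1+ n ]^ q *_) (trans (∏ˡ-cong v (H≡ n)) (∏-+ (λ s → - 1ℚ * T n s) z v)) ⟩
        1/[1+ n ]^ q * ∑ˡ[ (b , r) ∈ splits v ] (∏ˡ b (λ s → - 1ℚ * T n s) * ∏ˡ r z)
          ≡⟨ *-∑ˡ (1/[1+ n ]^ q) _ (splits v) ⟩
        ∑ˡ[ (b , r) ∈ splits v ] (1/[1+ n ]^ q * (∏ˡ b (λ s → - 1ℚ * T n s) * ∏ˡ r z))
          ≡⟨ ∑ˡ-cong (splits v) (λ (b , r) → trans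
               (cong (λ t → 1/[1+ n ]^ q * (t * ∏ˡ r z)) (∏-negate (T n) b))
               (solve 4 (λ a e t z → a :* ((e :* t) :* z) := (e :* z) :* (a :* t)) refl
                 (1/[1+ n ]^ q) ((- 1ℚ) ^ length b) (∏ˡ b (T n)) (∏ˡ r z))) ⟩
        ∑ˡ (splits v) (λ s → term s n) ∎

-- Passage to real numbers

open import Defs
open import Data.Fin using (Fin)
open import Data.List using ([]; _∷_; _++_; upTo)
open import Data.Nat using (ℕ; suc; _≤_)
open import Data.Nat.Properties using (<⇒≤)
open import Data.Fin.Base using (zero)
open import Data.Fin.Permutation using (Permutation′)
open import Data.List.Base using (List; map; tabulate)
open import Data.Nat.Base using (zero)
open import Data.Nat.ListAction using (sum)
open import Data.Product.Base using (_,_)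
open import Data.Rational.Base as ℚ using (ℚ; 0ℚ; 1ℚ; ∣_∣)
import Data.Rational.Properties as ℚ
open import Algebra.Definitions.RawSemiring ℚ.+-*-rawSemiring using () renaming (_^_ to _^ℚ_)
open import Function.Base using (_∘_)
open import Relation.Binary.PropositionalEquality
open Truncated using (∑ˡ; arrangements; ∑-permutations; ∑<-eulerTerm; orderedSum; 1/factorials)

seq-∏ : ∀ {n} (f : Fin n → ℝ) N → seq (∏ f) N ≡ ∏ℚ (λ k → seq (f k) N)
seq-∏ {zero}  f N = refl
seq-∏ {suc n} f N = cong (seq (f zero) N ℚ.*_) (seq-∏ (λ k → f (Fin.suc k)) N)

seq-^ : ∀ x l N → seq (x ^ l) N ≡ seq x N ^ℚ l
seq-^ x zero    N = refl
seq-^ x (suc l) N = cong (seq x N ℚ.*_) (seq-^ x l N)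

-- `ζ` reduces only when its list and admissibility proof are constructors, which those for `J̃` are
-- not.
seq-ζ : ∀ ss (adm : Admissible ss) N → seq (ζ ss adm) N ≡ mzv ss N
seq-ζ (s ∷ ss) (_ ∷ _) N = refl

-- The lower bound in `ζ₁#0` is the first term of the series and holds from index 1 on, hence for
-- each of these partial sums.
mzv-singleton≢0 : ∀ {s} → 2 ≤ s → ∀ {N} → 1 ≤ N → mzv (s ∷ []) N ≢ 0ℚ
mzv-singleton≢0 {s} 2≤s {N} 1≤N eq =
  let (δ , 0<δ , _ , δ≤) = ζ₁#0 s 2≤s
  in ℚ.<-irrefl refl (ℚ.<-≤-trans 0<δ (subst (λ t → δ ℚ.≤ ∣ t ∣) eq (δ≤ N 1≤N)))


-- Each level of the nested sum is expanded by induction on its list of indices,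
-- with the summand spelled out in the signature.  Passing summands to a general
-- lemma instead would expand _^_ and ∏ in them, and Agda would have to compare the
-- proofs of Cauchyness of products, which is infeasible.
module _ {m} (i : Fin m → ℕ) (i≥2 : ∀ k → 2 ≤ i k) (q : ℕ) (q≥2 : 2 ≤ q) where

  seq-∑-permutations : ∀ {l} (j : Increasing l m) η (τs : List (Permutation′ l)) N →
    seq (∑[ τ ∈ τs ]
      (ζ (J̃ i j η τ ++ q ∷ []) (J̃-admissible i≥2 q≥2 j η τ)
        ÷ fromℕ (factorials (parts η))
        [ fromℕ#0 (factorials (parts η)) {{factorials≢0 (parts η)}} ])) N
      ≡ ∑ˡ τs (λ τ → mzv (J̃ i j η τ ++ q ∷ []) N ℚ.* 1/factorials (parts η))
  seq-∑-permutations j η []       N = refl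
  seq-∑-permutations j η (τ ∷ τs) N = cong₂ ℚ._+_
    (cong₂ ℚ._*_
      (seq-ζ (J̃ i j η τ ++ q ∷ []) (J̃-admissible i≥2 q≥2 j η τ) N)
      -- `fromℕ` embeds the factorials as fractions over 1, `1/factorials` as repeated sums of 1.
      (cong invℚ (sym (Convergence.⟦⟧-/ (factorials (parts η))))))
    (seq-∑-permutations j η τs N)

  seq-∑-compositions : ∀ {l} (j : Increasing l m) (ηs : List (Composition l)) N →
    seq (∑[ η ∈ ηs ]
      (∑[ τ ∈ elements (permutations l) ]
        (ζ (J̃ i j η τ ++ q ∷ []) (J̃-admissible i≥2 q≥2 j η τ)
          ÷ fromℕ (factorials (parts η))
          [ fromℕ#0 (factorials (parts η)) {{factorials≢0 (parts η)}} ]))) N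
      ≡ ∑ˡ ηs (λ η → ∑ˡ (arrangements l (tabulate (i ∘ at j)))
          (λ w → mzv (map sum (blocks (parts η) w) ++ q ∷ []) N ℚ.* 1/factorials (parts η)))
  seq-∑-compositions         j []       N = refl
  seq-∑-compositions {l = l} j (η ∷ ηs) N = cong₂ ℚ._+_
    (trans
      (seq-∑-permutations j η (elements (permutations l)) N)
      (∑-permutations l (i ∘ at j) λ w →
        mzv (map sum (blocks (parts η) w) ++ q ∷ []) N ℚ.* 1/factorials (parts η)))
    (seq-∑-compositions j ηs N)

  seq-∑-increasing : ∀ {l} (js : List (Increasing l m)) N →
    seq (∑[ j ∈ js ]
      ((∏ (λ k → ζ₁ (i k) (i≥2 k))
        ÷ ∏ (λ k → ζ₁ (i (at j k)) (i≥2 (at j k)))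
        [ ∏#0 _ (λ k → ζ₁#0 (i (at j k)) (i≥2 (at j k))) ]) *
       (∑[ η ∈ elements (compositions l) ]
         (∑[ τ ∈ elements (permutations l) ]
           (ζ (J̃ i j η τ ++ q ∷ []) (J̃-admissible i≥2 q≥2 j η τ)
             ÷ fromℕ (factorials (parts η))
             [ fromℕ#0 (factorials (parts η)) {{factorials≢0 (parts η)}} ]))))) N
      ≡ ∑ˡ js (λ j →
          ∏ℚ (λ k → mzv (i k ∷ []) N) ℚ.* invℚ (∏ℚ (λ k → mzv (i (at j k) ∷ []) N))
            ℚ.* orderedSum q N l (tabulate (i ∘ at j)))
  seq-∑-increasing         []       N = refl
  seq-∑-increasing {l = l} (j ∷ js) N = cong₂ ℚ._+_
    (cong₂ ℚ._*_
      (cong₂ (λ a b → a ℚ.* invℚ b)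
        (seq-∏ (λ k → ζ₁ (i k) (i≥2 k)) N) (seq-∏ (λ k → ζ₁ (i (at j k)) (i≥2 (at j k))) N))
      (seq-∑-compositions j (elements (compositions l)) N))
    (seq-∑-increasing js N)

  seq-∑-alternating : ∀ ls N →
    seq (∑[ l ∈ ls ] ((- 1ℝ) ^ l *
      (∑[ j ∈ elements (increasing l m) ]
        ((∏ (λ k → ζ₁ (i k) (i≥2 k))
          ÷ ∏ (λ k → ζ₁ (i (at j k)) (i≥2 (at j k)))
          [ ∏#0 _ (λ k → ζ₁#0 (i (at j k)) (i≥2 (at j k))) ]) *
         (∑[ η ∈ elements (compositions l) ]
           (∑[ τ ∈ elements (permutations l) ]
             (ζ (J̃ i j η τ ++ q ∷ []) (J̃-admissible i≥2 q≥2 j η τ)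
               ÷ fromℕ (factorials (parts η))
               [ fromℕ#0 (factorials (parts η)) {{factorials≢0 (parts η)}} ]))))))) N
      ≡ ∑ˡ ls (λ l → (ℚ.- 1ℚ) ^ℚ l ℚ.* ∑ˡ (increasingList l m) (λ j →
          ∏ℚ (λ k → mzv (i k ∷ []) N) ℚ.* invℚ (∏ℚ (λ k → mzv (i (at j k) ∷ []) N))
            ℚ.* orderedSum q N l (tabulate (i ∘ at j))))
  seq-∑-alternating []       N = refl
  seq-∑-alternating (l ∷ ls) N = cong₂ ℚ._+_
    (cong₂ ℚ._*_ (seq-^ (- 1ℝ) l N) (seq-∑-increasing (elements (increasing l m)) N))
    (seq-∑-alternating ls N)

theorem2p2 :
    (m : ℕ) → 1 ≤ m →
    (i : Fin m → ℕ) (i≥2 : ∀ k → 2 ≤ i k) →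
    (q : ℕ) (q≥2 : 2 ≤ q) →
    S i q (λ k → <⇒≤ (i≥2 k)) q≥2
      ≃ (∑[ l ∈ upTo (suc m) ] ((- 1ℝ) ^ l *
          (∑[ j ∈ elements (increasing l m) ]
            ((∏ (λ k → ζ₁ (i k) (i≥2 k))
                ÷ ∏ (λ k → ζ₁ (i (at j k)) (i≥2 (at j k)))
                [ ∏#0 _ (λ k → ζ₁#0 (i (at j k)) (i≥2 (at j k))) ]) *
             (∑[ η ∈ elements (compositions l) ]
               (∑[ τ ∈ elements (permutations l) ]
                 (ζ (J̃ i j η τ ++ q ∷ []) (J̃-admissible i≥2 q≥2 j η τ)
                   ÷ fromℕ (factorials (parts η))
                   [ fromℕ#0 (factorials (parts η)) {{factorials≢0 (parts η)}} ])))))))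
-- From index 1 on the truncated zeta values in the denominators are nonzero and the two sequences
-- are equal, so one index serves every `ε`.
theorem2p2 m _ i i≥2 q q≥2 ε 0<ε = 1 , λ n 1≤n →
  subst (λ t → ∣ seq (S i q (λ k → <⇒≤ (i≥2 k)) q≥2) n ℚ.- t ∣ ℚ.< ε)
    (trans
      (∑<-eulerTerm q i n λ k → mzv-singleton≢0 (i≥2 k) 1≤n)
      (sym (seq-∑-alternating i i≥2 q q≥2 (upTo (suc m)) n)))
    (Ineq.∣p-p∣<ε (seq (S i q (λ k → <⇒≤ (i≥2 k)) q≥2) n) 0<ε)
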